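{- Let $\alpha$ be a peak composition of $n$. Then \[\tilde{Q}_\alpha = \sum_{T\in \mathrm{SPCT}(\alpha)}K_{\mathrm{comp}_n(\mathrm{Peak}_{\uparrow}(T))}.\]
   Context: Let $n$ be a positive integer, $[n]=\{1,\dots,n\}$. A composition $\alpha=(\alpha_1,\dots,\alpha_k)$ of $n$ (written $\alpha\vDash n$) is a finite sequence of positive integers summing to $n$. It is a peak composition if all parts except possibly the last are greater than $1$. Put $\mathrm{set}(\alpha)=\{\alpha_1,\alpha_1+\alpha_2,\dots,\alpha_1+\cdots+\alpha_{k-1}\}\subseteq[n-1]$. For $X=\{x_1<\dots<x_r\}\subseteq[n-1]$, $\mathrm{comp}_n(X)=(x_1,x_2-x_1,\dots,x_r-x_{r-1},n-x_r)$. A composition $\beta$ refines $\alpha$ if $\alpha$ can be obtained by summing consecutive entries of $\beta$. For $X\subseteq[n]$, $\mathrm{Peak}(X)=\{i\in X: i-1\notin X,\ i\neq 1\}$, and $\mathrm{Peak}(\alpha)=\mathrm{Peak}(\mathrm{set}(\alpha))$. Functions: formal power series in $x_1,x_2,\dots$. $M_\alpha=\sum_{1\le i_1<\cdots<i_k}x_{i_1}^{\alpha_1}\cdots x_{i_k}^{\alpha_k}$; $F_\alpha=\sum_{\beta\text{ refines }\alpha}M_\beta$. For a peak composition $\alpha$ of $n$, the peak function is $K_\alpha=2^{|\mathrm{Peak}(\alpha)|+1}\sum F_\beta$, the sum over $\beta\vDash n$ with $\mathrm{Peak}(\alpha)\subseteq \mathrm{set}(\beta)\,\triangle\,(\mathrm{set}(\beta)+1)$,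 where $\mathrm{set}(\beta)+1=\{i+1:i\in\mathrm{set}(\beta)\}$ and $\triangle$ is symmetric difference. Diagrams: the diagram $D_\alpha$ is the left-justified array of boxes whose $i$th row from the bottom has $\alpha_i$ boxes; $(c,r)$ denotes the box in column $c$ (leftmost is 1) and row $r$ (bottom is 1). A filling $T$ of $D_\alpha$ assigns an entry $T(c,r)$ to each box. Marked peak composition tableaux: for a peak composition $\alpha$ of $n$, a marked peak composition tableau of shape $\alpha$ is a filling $T$ of $D_\alpha$ with entries from the ordered alphabet $1'<1<2'<2<\cdots$ (primed entries are called marked) such that: (1) entries in each row weakly increase left to right, with no repeated marked entries in a row; (2) entries in the first column strictly increase from bottom to top; (3) for any $k\le n$, the boxes with entries in $\{1',1,\dots,k',k\}$ form the diagram of a peak composition; (4) if an unmarked entry $i$ is in box $(2,r)$ for some row $r$, then neither $i$ nor $i'$ is in box $(1,r+1)$. The weight $\mathrm{wt}(T)$ has $i$th entry equal to the number of occurrences of $i$ or $i'$. $\mathrm{MPCT}(\alpha)$ is the set of such tableaux of shape $\alpha$ whose weight has no zero entry to the left of a nonzero entry (so $\mathrm{wt}(T)$, omitting trailing zeros, is a composition of $n$). The quasisymmetric Schur $Q$-function is $\tilde{Q}_\alpha=\sum_{T\in\mathrm{MPCT}(\alpha)}M_{\mathrm{wt}(T)}$. Standard peak composition tableaux: for a peak composition $\alpha$ of $n$, $\mathrm{SPCT}(\alpha)$ is the set of fillings $T$ of $D_\alpha$ with entries from $[n]$, each used once, such that: (1) entries in each row increase left to right; (2) entries in the first column increase from bottom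 to top; (3) for all $k\le n$, the boxes with entries at most $k$ form the diagram of a peak composition. For such $T$, $\mathrm{Des}_{\uparrow}(T)=\{i\in[n-1]: i+1\text{ is in a row strictly above that of } i\text{ in }T\}$, and $\mathrm{Peak}_{\uparrow}(T)=\mathrm{Peak}(\mathrm{Des}_{\uparrow}(T))$. -}

module Defs where

open import Data.Bool using (if_then_else_)
open import Data.Empty using (⊥-elim)
open import Data.Fin as Fin using (Fin; zero; suc; toℕ)
open import Data.Fin.Properties as Finₚ using ()
open import Data.Integer as ℤ using (ℤ)
open import Data.List using (List; []; _∷_; _++_; map; filter; length; foldr;
  concatMap; zipWith; upTo; allFin; deduplicate; cartesianProductWith; lookup)
import Data.List.Properties as Listₚ
open import Data.List.Membership.Propositional using (_∈_; find; lose)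
open import Data.List.Membership.Propositional.Properties using (∈-map⁺; ∈-++⁺ˡ; ∈-++⁺ʳ;
  ∈-concatMap⁺; ∈-cartesianProductWith⁺; ∈-filter⁺; ∈-filter⁻; ∈-upTo⁺; ∈-allFin;
  ∈-deduplicate⁺; ∈-deduplicate⁻; ∈-length)
open import Data.List.Membership.DecPropositional as DecMembership using ()
open import Data.List.NonEmpty as List⁺ using (List⁺; _∷⁺_) renaming (_∷_ to _◂_)
open import Data.List.Relation.Unary.All as All using (All; []; _∷_)
open import Data.List.Relation.Unary.Any as Any using (Any; here; there)
open import Data.List.Relation.Unary.Any.Properties using (lookup-index)
open import Data.List.Relation.Unary.Linked as Linked using (Linked)
open import Data.List.Relation.Unary.Unique.Propositional using (Unique)
import Data.List.Relation.Unary.Unique.DecPropositional.Properties as Uniqueₚ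
open import Data.Nat using (ℕ; zero; suc; _+_; _*_; _∸_; _^_; _⊔_; _≤_; _<_; z≤n; s≤s;
  _≟_; _≤?_; _<?_)
open import Data.Nat.ListAction using (sum)
open import Data.Nat.Properties
open import Data.Product using (∃; ∃-syntax; _×_; _,_; proj₁; proj₂)
open import Data.Sum using (_⊎_)
open import Data.Vec as Vec using (Vec; []; _∷_)
import Data.Vec.Properties as Vecₚ
open import Function using (_∘_; _⇔_; mk⇔)
open import Relation.Binary.Definitions using (DecidableEquality)
open import Relation.Binary.PropositionalEquality using (_≡_; _≢_; refl; sym; trans; cong;
  cong₂; subst)
open import Relation.Nullary using (¬_; Dec; yes; no; does)
open import Relation.Nullary.Decidable using (map′; _×-dec_; _⊎-dec_; _→-dec_; ¬?)
open import Relation.Unary using (Pred; Decidable; _≐_)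

infix  4 _≈_ _⊨_ _⊨ᴾ_ _Refines_ _≼_ _≺_
infixl 9 _‼_

private variable
  A : Set

open DecMembership _≟_ using (_∈?_)

infix 9 1…_
1…_ : ℕ → List ℕ
1… n = map suc (upTo n)

∈-1… : ∀ {i n} → 1 ≤ i → i ≤ n → i ∈ 1… n
∈-1… {suc i} _ i≤n = ∈-map⁺ suc (∈-upTo⁺ i≤n)

record Enumeration {A : Set} (P : A → Set) : Set where
  field
    elements : List A
    unique   : Unique elements
    member   : ∀ {x} → x ∈ elements ⇔ P x

open Enumeration public

enumerate : {P : A → Set} → DecidableEquality A → Decidable P →
            (candidates : List A) → (∀ {x} → P x → x ∈ candidates) → Enumeration P
enumerate eq? P? cs complete = record
  { elements = deduplicate eq? (filter P? cs)
  ; unique   = Uniqueₚ.deduplicate-! eq? _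
  ; member   = mk⇔ (λ x∈ → proj₂ (∈-filter⁻ P? {xs = cs} (∈-deduplicate⁻ eq? _ x∈)))
                   (λ px → ∈-deduplicate⁺ eq? (∈-filter⁺ P? (complete px) px))
  }

words : List A → ℕ → List (List A)
words xs zero    = [] ∷ []
words xs (suc k) = cartesianProductWith _∷_ xs (words xs k)

∈-words : ∀ {xs : List A} {ys} → All (_∈ xs) ys → ys ∈ words xs (length ys)
∈-words []       = here refl
∈-words (p ∷ ps) = ∈-cartesianProductWith⁺ _∷_ p (∈-words ps)

-- The list (e₁, …, e_N) stands for the monomial x₁^e₁ ⋯ x_N^e_N; lists that differ only in
-- trailing zeros stand for the same monomial.
Monomial : Set
Monomial = List ℕ

Series : Set
Series = Monomial → ℤ

_≈_ : Series → Series → Set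
f ≈ g = ∀ e → f e ≡ g e

∑ : {P : A → Set} → Enumeration P → (A → Series) → Series
∑ E f e = foldr (λ x s → f x e ℤ.+ s) ℤ.0ℤ (elements E)

infixr 7 _•_
_•_ : ℕ → Series → Series
(c • f) e = ℤ.+ c ℤ.* f e

_⊨_ : List ℕ → ℕ → Set
α ⊨ n = All (0 <_) α × sum α ≡ n

PeakShape : List ℕ → Set
PeakShape α = ∀ (i : Fin (length α)) → suc (toℕ i) < length α → 1 < lookup α i

-- The empty sequence counts as the (peak) composition of 0; its diagram is empty.
_⊨ᴾ_ : List ℕ → ℕ → Set
α ⊨ᴾ n = α ⊨ n × PeakShape α

-- Finite sets of naturals such as set(α) are lists in increasing order.
set : List ℕ → List ℕ
set []          = []
set (a ∷ [])    = []
set (a ∷ b ∷ α) = a ∷ map (a +_) (set (b ∷ α))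

comp : ℕ → List ℕ → List ℕ
comp n = from 0
  where
  from : ℕ → List ℕ → List ℕ
  from p []       = n ∸ p ∷ []
  from p (x ∷ xs) = x ∸ p ∷ from x xs

Peak : List ℕ → List ℕ
Peak X = filter (λ i → ¬? (i ∸ 1 ∈? X) ×-dec ¬? (i ≟ 1)) X

_△_ : List ℕ → List ℕ → Pred ℕ _
(X △ Y) i = (i ∈ X × ¬ i ∈ Y) ⊎ (¬ i ∈ X × i ∈ Y)

-- The blocks are the runs of consecutive entries of β that are summed.
_Refines_ : List ℕ → List ℕ → Set
β Refines α = ∃[ blocks ] concatMap List⁺.toList blocks ≡ β
                        × map (sum ∘ List⁺.toList) blocks ≡ α

_≟ᴸ_ : DecidableEquality (List ℕ)
_≟ᴸ_ = Listₚ.≡-dec _≟_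

⊨? : ∀ α n → Dec (α ⊨ n)
⊨? α n = All.all? (0 <?_) α ×-dec (sum α ≟ n)

peakShape? : Decidable PeakShape
peakShape? α = Finₚ.all? λ i → (suc (toℕ i) <? length α) →-dec (1 <? lookup α i)

△? : ∀ X Y → Decidable (X △ Y)
△? X Y i = ((i ∈? X) ×-dec ¬? (i ∈? Y)) ⊎-dec (¬? (i ∈? X) ×-dec (i ∈? Y))

splittings : List ℕ → List (List (List⁺ ℕ))
splittings []       = [] ∷ []
splittings (x ∷ xs) = concatMap extend (splittings xs)
  where
  extend : List (List⁺ ℕ) → List (List (List⁺ ℕ))
  extend []       = ((x ◂ []) ∷ []) ∷ []
  extend (b ∷ bs) = ((x ∷⁺ b) ∷ bs) ∷ ((x ◂ []) ∷ b ∷ bs) ∷ []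

∈-splittings : ∀ blocks → blocks ∈ splittings (concatMap List⁺.toList blocks)
∈-splittings []                      = here refl
∈-splittings ((x ◂ xs) ∷ bs)          = block bs (∈-splittings bs) x xs
  where
  block : ∀ bs → bs ∈ splittings (concatMap List⁺.toList bs) → ∀ x xs →
          ((x ◂ xs) ∷ bs) ∈ splittings (concatMap List⁺.toList ((x ◂ xs) ∷ bs))
  block []       _ x []       = here refl
  block (b ∷ bs) p x []       = ∈-concatMap⁺ _ (lose p (there (here refl)))
  block bs       p x (y ∷ ys) = ∈-concatMap⁺ _ (lose (block bs p y ys) (here refl))

refines? : ∀ β α → Dec (β Refines α)
refines? β α = map′ to from
  (Any.any? (λ bs → (concatMap List⁺.toList bs ≟ᴸ β) ×-dec (map (sum ∘ List⁺.toList) bs ≟ᴸ α))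
            (splittings β))
  where
  to   = λ p → let (bs , _ , q) = find p in bs , q
  from : β Refines α → Any _ (splittings β)
  from (bs , refl , q) = lose (∈-splittings bs) (refl , q)

increment : List ℕ → List ℕ
increment []      = []
increment (a ∷ α) = suc a ∷ α

compositions : ℕ → List (List ℕ)
compositions zero    = [] ∷ []
compositions (suc n) = map (1 ∷_) (compositions n) ++ map increment (compositions n)

∈-compositions : ∀ n {α} → α ⊨ n → α ∈ compositions n
∈-compositions zero    {[]}              _               = here refl
∈-compositions zero    {suc _ ∷ _}       (_ , ())
∈-compositions zero    {zero ∷ _}        (() ∷ _ , _)
∈-compositions (suc n) {[]}              (_ , ())
∈-compositions (suc n) {zero ∷ _}        (() ∷ _ , _)
∈-compositions (suc n) {suc zero ∷ α}    (_ ∷ ps , eq)   =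
  ∈-++⁺ˡ (∈-map⁺ (1 ∷_) (∈-compositions n (ps , suc-injective eq)))
∈-compositions (suc n) {suc (suc a) ∷ α} (_ ∷ ps , eq)   =
  ∈-++⁺ʳ (map (1 ∷_) (compositions n))
    (∈-map⁺ increment (∈-compositions n {suc a ∷ α} (s≤s z≤n ∷ ps , suc-injective eq)))

-- Exponent of x_j in x_{i₁}^α₁ ⋯ x_{i_k}^α_k.
exponent : List ℕ → List ℕ → ℕ → ℕ
exponent is α j = sum (zipWith (λ i a → if does (i ≟ j) then a else 0) is α)

-- Index sequences 1 ≤ i₁ < ⋯ < i_k whose term of M_α is the monomial e. A variable beyond the
-- length of e cannot divide that monomial, so for positive α bounding the indices loses nothing.
MTerm : List ℕ → Monomial → List ℕ → Set
MTerm α e is = length is ≡ length α × Linked _<_ is × All (_∈ 1… length e) is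
             × map (exponent is α) (1… length e) ≡ e

M-terms : ∀ α e → Enumeration (MTerm α e)
M-terms α e = enumerate _≟ᴸ_
  (λ is → (length is ≟ length α) ×-dec Linked.linked? _<?_ is
          ×-dec All.all? (_∈? 1… length e) is
          ×-dec (map (exponent is α) (1… length e) ≟ᴸ e))
  (words (1… length e) (length α))
  (λ { {is} (len , _ , bnd , _) → subst (λ k → is ∈ words _ k) len (∈-words bnd) })

M : List ℕ → Series
M α e = ℤ.+ length (elements (M-terms α e))

FIndex : List ℕ → List ℕ → Set
FIndex α β = β ⊨ sum α × β Refines α

refinements : ∀ α → Enumeration (FIndex α)
refinements α = enumerate _≟ᴸ_ (λ β → ⊨? β (sum α) ×-dec refines? β α)
  (compositions (sum α)) (∈-compositions (sum α) ∘ proj₁)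

F : List ℕ → Series
F α = ∑ (refinements α) M

KIndex : List ℕ → List ℕ → Set
KIndex α β = β ⊨ sum α × All (set β △ map suc (set β)) (Peak (set α))

K-indices : ∀ α → Enumeration (KIndex α)
K-indices α = enumerate _≟ᴸ_
  (λ β → ⊨? β (sum α) ×-dec All.all? (△? (set β) (map suc (set β))) (Peak (set α)))
  (compositions (sum α)) (∈-compositions (sum α) ∘ proj₁)

K : List ℕ → Series
K α = 2 ^ (length (Peak (set α)) + 1) • ∑ (K-indices α) F

-- Row lengths are listed from the bottom row up.
Box : List ℕ → Set
Box α = Any Fin α

private variable
  α β : List ℕ

row : Box α → ℕ
row (here _)  = 1
row (there b) = suc (row b)

col : Box α → ℕ
col (here c)  = suc (toℕ c)
col (there b) = col b

position : Box α → ℕ × ℕ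
position b = col b , row b

D : List ℕ → Pred (ℕ × ℕ) _
D α p = ∃[ b ] position {α} b ≡ p

Filling : Set → List ℕ → Set
Filling A α = All (Vec A) α

_‼_ : Filling A α → Box α → A
(v ∷ T) ‼ here c  = Vec.lookup v c
(v ∷ T) ‼ there b = T ‼ b

boxes : ∀ α → List (Box α)
boxes []      = []
boxes (a ∷ α) = map here (allFin a) ++ map there (boxes α)

FormPeakDiagram : (Box α → Set) → Set
FormPeakDiagram P = ∃[ β ] β ⊨ᴾ sum β × (λ p → ∃[ b ] position b ≡ p × P b) ≐ D β

occurrences : {P : A → Set} → Decidable P → Filling A α → ℕ
occurrences {α = α} P? T = length (filter (λ b → P? (T ‼ b)) (boxes α))

∈-boxes : (b : Box α) → b ∈ boxes α
∈-boxes {a ∷ α} (here c)  = ∈-++⁺ˡ (∈-map⁺ here (∈-allFin c))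
∈-boxes {a ∷ α} (there b) = ∈-++⁺ʳ (map here (allFin a)) (∈-map⁺ there (∈-boxes b))

length-boxes : ∀ α → length (boxes α) ≡ sum α
length-boxes []      = refl
length-boxes (a ∷ α) = trans (Listₚ.length-++ bottom) (cong₂ _+_
  (trans (Listₚ.length-map (here {P = Fin} {xs = α}) (allFin a)) (Listₚ.length-tabulate {n = a} (λ c → c)))
  (trans (Listₚ.length-map (there {P = Fin} {x = a}) (boxes α)) (length-boxes α)))
  where
  bottom : List (Box (a ∷ α))
  bottom = map here (allFin a)

all-boxes? : {P : Box α → Set} → Decidable P → Dec (∀ b → P b)
all-boxes? {α} P? = map′ (λ ps b → All.lookup ps (∈-boxes b)) (λ f → All.tabulate (λ _ → f _))
  (All.all? P? (boxes α))

any-box? : {P : Box α → Set} → Decidable P → Dec (∃ P)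
any-box? {α} P? = map′ (λ p → let (b , _ , q) = find p in b , q) (λ (b , q) → lose (∈-boxes b) q)
  (Any.any? P? (boxes α))

all≤? : {P : ℕ → Set} → Decidable P → ∀ n → Dec (∀ k → k ≤ n → P k)
all≤? {P} P? n = map′ to (λ f k<1+n → f _ (≤-pred k<1+n)) (allUpTo? P? (suc n))
  where
  to : (∀ {k} → k < suc n → P k) → ∀ k → k ≤ n → P k
  to f k k≤n = f (s≤s k≤n)

col-positive : (b : Box α) → 1 ≤ col b
col-positive (here c)  = s≤s z≤n
col-positive (there b) = col-positive b

row-positive : (b : Box α) → 1 ≤ row b
row-positive (here c)  = s≤s z≤n
row-positive (there b) = s≤s z≤n

D⊆⇒sum≤ : ∀ α β → (∀ (b : Box β) → D α (position b)) → sum β ≤ sum α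
D⊆⇒sum≤ α       []          _ = z≤n
D⊆⇒sum≤ []      (zero ∷ β)  f = D⊆⇒sum≤ [] β λ b → ⊥-elim (noBox (proj₁ (f (there b))))
  where
  noBox : ¬ Box []
  noBox ()
D⊆⇒sum≤ []      (suc b ∷ β) f with f (here zero)
... | () , _
D⊆⇒sum≤ (a ∷ α) (b ∷ β)     f = +-mono-≤ (bottom b (f ∘ here)) (D⊆⇒sum≤ α β (shift ∘ f ∘ there))
  where
  bottom : ∀ b → (∀ (c : Fin b) → D (a ∷ α) (suc (toℕ c) , 1)) → b ≤ a
  bottom zero    _ = z≤n
  bottom (suc b) g with g (Fin.fromℕ b)
  ... | here c  , eq = subst (_≤ a)
    (trans (cong proj₁ eq) (cong suc (Finₚ.toℕ-fromℕ b))) (Finₚ.toℕ<n c)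
  ... | there d , eq with subst (1 ≤_) (suc-injective (cong proj₂ eq)) (row-positive d)
  ...   | ()
  shift : ∀ {d : Box β} → D (a ∷ α) (position (there {x = b} d)) → D α (position d)
  shift {d} (here c  , eq) with subst (1 ≤_) (sym (suc-injective (cong proj₂ eq))) (row-positive d)
  ... | ()
  shift     (there e , eq) = e , cong₂ _,_ (cong proj₁ eq) (suc-injective (cong proj₂ eq))

position? : ∀ (p q : ℕ × ℕ) → Dec (p ≡ q)
position? (c , r) (c′ , r′) =
  map′ (λ (x , y) → cong₂ _,_ x y) (λ { refl → refl , refl }) ((c ≟ c′) ×-dec (r ≟ r′))

formPeakDiagram? : {P : Box α → Set} → Decidable P → Dec (FormPeakDiagram P)
formPeakDiagram? {α} {P} P? = map′ to from (Any.any? good? candidates)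
  where
  Good : List ℕ → Set
  Good β = β ⊨ᴾ sum β × (λ p → ∃[ b ] position {α} b ≡ p × P b) ≐ D β

  candidates = concatMap compositions (upTo (suc (sum α)))

  good? : Decidable Good
  good? β = (⊨? β (sum β) ×-dec peakShape? β) ×-dec map′
    (λ (f , g) → (λ { (b , refl , pb) → f b pb }) , (λ { (b , refl) → g b }))
    (λ (f , g) → (λ b pb → f (b , refl , pb)) , (λ b → g (b , refl)))
    ( all-boxes? (λ b → P? b →-dec any-box? (λ b′ → position? (position b′) (position b)))
      ×-dec
      all-boxes? (λ b → any-box? (λ b′ → position? (position b′) (position b) ×-dec P? b′)))

  to : Any Good candidates → FormPeakDiagram P
  to p = let (β , _ , q) = find p in β , q

  from : FormPeakDiagram P → Any Good candidates
  from (β , g@((β⊨ , _) , (_ , D⊆))) =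
    lose (∈-concatMap⁺ compositions
            (lose (∈-upTo⁺ (s≤s (D⊆⇒sum≤ α β λ b → let (b′ , eq , _) = D⊆ (b , refl) in b′ , eq)))
                  (∈-compositions (sum β) β⊨))) g

vectors : List A → ∀ k → List (Vec A k)
vectors xs zero    = [] ∷ []
vectors xs (suc k) = cartesianProductWith _∷_ xs (vectors xs k)

∈-vectors : ∀ {xs : List A} {k} (v : Vec A k) → (∀ c → Vec.lookup v c ∈ xs) → v ∈ vectors xs k
∈-vectors []      _ = here refl
∈-vectors (x ∷ v) h = ∈-cartesianProductWith⁺ _∷_ (h zero) (∈-vectors v (h ∘ suc))

fillings : List A → ∀ α → List (Filling A α)
fillings xs []      = [] ∷ []
fillings xs (a ∷ α) = cartesianProductWith _∷_ (vectors xs a) (fillings xs α)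

∈-fillings : ∀ {xs} (T : Filling A α) → (∀ b → T ‼ b ∈ xs) → T ∈ fillings xs α
∈-fillings []      _ = here refl
∈-fillings (v ∷ T) h =
  ∈-cartesianProductWith⁺ _∷_ (∈-vectors v (h ∘ here)) (∈-fillings T (h ∘ there))

filling? : DecidableEquality A → DecidableEquality (Filling A α)
filling? eq? []      []      = yes refl
filling? eq? (v ∷ T) (w ∷ U) = map′ (λ (p , q) → cong₂ _∷_ p q) (λ { refl → refl , refl })
  (Vecₚ.≡-dec eq? v w ×-dec filling? eq? T U)

data Letter : Set where
  marked unmarked : ℕ → Letter

value : Letter → ℕ
value (marked i)   = i
value (unmarked i) = i

-- Embeds the alphabet in ℕ so that marked i < unmarked i < marked (suc i).
rank : Letter → ℕ
rank (marked i)   = 2 * i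
rank (unmarked i) = suc (2 * i)

_≼_ _≺_ : Letter → Letter → Set
x ≼ y = rank x ≤ rank y
x ≺ y = rank x < rank y

record IsMarkedTableau (T : Filling Letter α) : Set where
  field
    positive      : ∀ b → 1 ≤ value (T ‼ b)
    rows-increase : ∀ b b′ → row b ≡ row b′ → col b < col b′ → T ‼ b ≼ T ‼ b′
    marked-once   : ∀ b b′ → row b ≡ row b′ → col b < col b′ →
                    ∀ i → T ‼ b ≡ marked i → T ‼ b′ ≢ marked i
    first-column  : ∀ b b′ → col b ≡ 1 → col b′ ≡ 1 → row b < row b′ → T ‼ b ≺ T ‼ b′
    initial       : ∀ k → k ≤ sum α → FormPeakDiagram (λ b → value (T ‼ b) ≤ k)
    second-column : ∀ b b′ → col b ≡ 2 → col b′ ≡ 1 → row b′ ≡ suc (row b) →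
                    ∀ i → T ‼ b ≡ unmarked i → T ‼ b′ ≢ unmarked i × T ‼ b′ ≢ marked i

wt : Filling Letter α → ℕ → ℕ
wt T i = occurrences (λ x → value x ≟ i) T

IsMPCT : Filling Letter α → Set
IsMPCT T = IsMarkedTableau T × (∀ i j → 1 ≤ i → i < j → wt T i ≡ 0 → wt T j ≡ 0)

maxValue : Filling Letter α → ℕ
maxValue {α} T = foldr _⊔_ 0 (map (λ b → value (T ‼ b)) (boxes α))

-- The entry at maxValue T is the last nonzero one, so this is wt(T) without trailing zeros.
weight : Filling Letter α → List ℕ
weight T = map (wt T) (1… maxValue T)

letter? : DecidableEquality Letter
letter? (marked i)   (marked j)   = map′ (cong marked) (λ { refl → refl }) (i ≟ j)
letter? (marked i)   (unmarked j) = no λ ()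
letter? (unmarked i) (marked j)   = no λ ()
letter? (unmarked i) (unmarked j) = map′ (cong unmarked) (λ { refl → refl }) (i ≟ j)

if-marked? : ∀ {P : ℕ → Set} x → Decidable P → Dec (∀ i → x ≡ marked i → P i)
if-marked? (marked i)   P? = map′ (λ { p _ refl → p }) (λ f → f i refl) (P? i)
if-marked? (unmarked i) P? = yes λ _ ()

if-unmarked? : ∀ {P : ℕ → Set} x → Decidable P → Dec (∀ i → x ≡ unmarked i → P i)
if-unmarked? (unmarked i) P? = map′ (λ { p _ refl → p }) (λ f → f i refl) (P? i)
if-unmarked? (marked i)   P? = yes λ _ ()

isMarkedTableau? : Decidable (IsMarkedTableau {α})
isMarkedTableau? {α} T = map′
  (λ (a , b , c , d , e , f) → record
    { positive = a ; rows-increase = b ; marked-once = c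
    ; first-column = d ; initial = e ; second-column = f })
  (λ t → let open IsMarkedTableau t in
    positive , rows-increase , marked-once , first-column , initial , second-column)
  ( all-boxes? (λ b → 1 ≤? value (T ‼ b))
    ×-dec all-boxes? (λ b → all-boxes? λ b′ → (row b ≟ row b′) →-dec (col b <? col b′) →-dec
      (rank (T ‼ b) ≤? rank (T ‼ b′)))
    ×-dec all-boxes? (λ b → all-boxes? λ b′ → (row b ≟ row b′) →-dec (col b <? col b′) →-dec
      if-marked? (T ‼ b) (λ i → ¬? (letter? (T ‼ b′) (marked i))))
    ×-dec all-boxes? (λ b → all-boxes? λ b′ → (col b ≟ 1) →-dec (col b′ ≟ 1) →-dec
      (row b <? row b′) →-dec (rank (T ‼ b) <? rank (T ‼ b′)))
    ×-dec all≤? (λ k → formPeakDiagram? (λ b → value (T ‼ b) ≤? k)) (sum α)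
    ×-dec all-boxes? (λ b → all-boxes? λ b′ → (col b ≟ 2) →-dec (col b′ ≟ 1) →-dec
      (row b′ ≟ suc (row b)) →-dec
      if-unmarked? (T ‼ b) (λ i → ¬? (letter? (T ‼ b′) (unmarked i))
                                  ×-dec ¬? (letter? (T ‼ b′) (marked i)))))

wt-value : (T : Filling Letter α) (b : Box α) → wt T (value (T ‼ b)) ≢ 0
wt-value T b wt≡0 with subst (0 <_) wt≡0
  (∈-length (∈-filter⁺ (λ b′ → value (T ‼ b′) ≟ value (T ‼ b)) (∈-boxes b) refl))
... | ()

wt≢0 : (T : Filling Letter α) → ∀ i → wt T i ≢ 0 → ∃[ b ] value (T ‼ b) ≡ i
wt≢0 {α} T i ≢0 with filter (λ b → value (T ‼ b) ≟ i) (boxes α) in eq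
... | []    = ⊥-elim (≢0 refl)
... | b ∷ _ = b , proj₂ (∈-filter⁻ (λ b → value (T ‼ b) ≟ i) {xs = boxes α}
                           (subst (b ∈_) (sym eq) (here refl)))

isMPCT? : Decidable (IsMPCT {α})
isMPCT? T = isMarkedTableau? T ×-dec map′ to from
  (all-boxes? λ b → allUpTo? (λ i → (1 ≤? i) →-dec ¬? (wt T i ≟ 0)) (value (T ‼ b)))
  where
  to : (∀ b {i} → i < value (T ‼ b) → 1 ≤ i → wt T i ≢ 0) →
       ∀ i j → 1 ≤ i → i < j → wt T i ≡ 0 → wt T j ≡ 0
  to f i j 1≤i i<j wtᵢ with wt T j ≟ 0
  ... | yes p = p
  ... | no ¬p with wt≢0 T j ¬p
  ...   | b , refl = ⊥-elim (f b i<j 1≤i wtᵢ)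
  from : (∀ i j → 1 ≤ i → i < j → wt T i ≡ 0 → wt T j ≡ 0) →
         ∀ b {i} → i < value (T ‼ b) → 1 ≤ i → wt T i ≢ 0
  from g b i<v 1≤i wtᵢ = wt-value T b (g _ _ 1≤i i<v wtᵢ)

-- All of 1, …, value (T ‼ b) occur, in distinct boxes.
value≤ : (T : Filling Letter α) → IsMPCT T → ∀ b → value (T ‼ b) ≤ sum α
value≤ {α} T (_ , packed) b = ≮⇒≥ λ n<v →
  let (i , j , i<j , eq) = Finₚ.pigeonhole
        (subst (_< value (T ‼ b)) (sym (length-boxes α)) n<v) (Any.index ∘ listed)
  in <⇒≢ i<j (suc-injective (trans (trans (sym (proj₂ (occurs i)))
       (cong (value ∘ (T ‼_)) (trans (lookup-index (listed i))
         (trans (cong (lookup (boxes α)) eq) (sym (lookup-index (listed j)))))))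
       (proj₂ (occurs j))))
  where
  occurs : (i : Fin (value (T ‼ b))) → ∃[ d ] value (T ‼ d) ≡ suc (toℕ i)
  occurs i with suc (toℕ i) ≟ value (T ‼ b)
  ... | yes p = b , sym p
  ... | no ¬p = wt≢0 T _ λ wt≡0 →
    wt-value T b (packed _ _ (s≤s z≤n) (≤∧≢⇒< (Finₚ.toℕ<n i) ¬p) wt≡0)
  listed : (i : Fin (value (T ‼ b))) → proj₁ (occurs i) ∈ boxes α
  listed i = ∈-boxes (proj₁ (occurs i))

MPCT : ∀ α → Enumeration (IsMPCT {α})
MPCT α = enumerate (filling? letter?) isMPCT? (fillings letters α)
  (λ {T} t → ∈-fillings T λ b →
    ∈-letters (IsMarkedTableau.positive (proj₁ t) b) (value≤ T t b))
  where
  letters = map marked (1… sum α) ++ map unmarked (1… sum α)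
  ∈-letters : ∀ {x} → 1 ≤ value x → value x ≤ sum α → x ∈ letters
  ∈-letters {marked i}   p q = ∈-++⁺ˡ (∈-map⁺ marked (∈-1… p q))
  ∈-letters {unmarked i} p q = ∈-++⁺ʳ (map marked (1… sum α)) (∈-map⁺ unmarked (∈-1… p q))

Q̃ : List ℕ → Series
Q̃ α = ∑ (MPCT α) (M ∘ weight)

record IsSPCT (T : Filling ℕ α) : Set where
  field
    range         : ∀ b → 1 ≤ T ‼ b × T ‼ b ≤ sum α
    once          : ∀ k → k ≤ sum α → 1 ≤ k → occurrences (_≟ k) T ≡ 1
    rows-increase : ∀ b b′ → row b ≡ row b′ → col b < col b′ → T ‼ b < T ‼ b′
    first-column  : ∀ b b′ → col b ≡ 1 → col b′ ≡ 1 → row b < row b′ → T ‼ b < T ‼ b′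
    initial       : ∀ k → k ≤ sum α → FormPeakDiagram (λ b → T ‼ b ≤ k)

isSPCT? : Decidable (IsSPCT {α})
isSPCT? {α} T = map′
  (λ (a , b , c , d , e) → record
    { range = a ; once = b ; rows-increase = c ; first-column = d ; initial = e })
  (λ t → let open IsSPCT t in range , once , rows-increase , first-column , initial)
  ( all-boxes? (λ b → (1 ≤? T ‼ b) ×-dec (T ‼ b ≤? sum α))
    ×-dec all≤? (λ k → (1 ≤? k) →-dec (occurrences (_≟ k) T ≟ 1)) (sum α)
    ×-dec all-boxes? (λ b → all-boxes? λ b′ → (row b ≟ row b′) →-dec (col b <? col b′) →-dec
      (T ‼ b <? T ‼ b′))
    ×-dec all-boxes? (λ b → all-boxes? λ b′ → (col b ≟ 1) →-dec (col b′ ≟ 1) →-dec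
      (row b <? row b′) →-dec (T ‼ b <? T ‼ b′))
    ×-dec all≤? (λ k → formPeakDiagram? (λ b → T ‼ b ≤? k)) (sum α))

SPCT : ∀ α → Enumeration (IsSPCT {α})
SPCT α = enumerate (filling? _≟_) isSPCT? (fillings (1… sum α) α)
  (λ {T} t → ∈-fillings T λ b → let (p , q) = IsSPCT.range t b in ∈-1… p q)

Des↑ : Filling ℕ α → List ℕ
Des↑ {α} T = filter
  (λ i → any-box? λ b → any-box? λ b′ → (T ‼ b ≟ i) ×-dec (T ‼ b′ ≟ suc i) ×-dec (row b <? row b′))
  (1… (sum α ∸ 1))

Peak↑ : Filling ℕ α → List ℕ
Peak↑ T = Peak (Des↑ T)

{-# OPTIONS --safe #-}
module Submission where

-- Fix a monomial and let γ be the sequence of its nonzero exponents, so that M_δ has coefficient 1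
-- if δ = γ and 0 otherwise. The left side counts the marked tableaux T of weight γ. Reading equal
-- marked entries of T from the bottom row up and equal unmarked ones from the top row down, left to
-- right, standardizes T to some S ∈ SPCT(α), and T is recovered from S and the marks along this
-- reading. A sequence of marks is possible for S iff, within each part of γ, it is marked on an
-- initial stretch with descents of S and unmarked on a final stretch with non-descents; condition
-- (4) is what makes the reading respect the peak shape of the initial diagrams.
--
-- On the right side, S with p peaks contributes 2^{p+1} times the number of β refined by γ such
-- that set(β) contains exactly one of i - 1 and i for every peak i. Both this number and the number
-- of mark sequences are given by transfer matrices along the descent word of S, and an induction on
-- its length relates them.

open import Defs
open import Data.Bool as Bool using (Bool; true; false; _∧_; _∨_; not; _xor_; if_then_else_)
open import Data.Bool.Properties using (∧-identityʳ; ∧-zeroʳ)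
open import Data.Empty using (⊥; ⊥-elim)
open import Data.Fin using (Fin; zero; suc; toℕ; fromℕ<)
import Data.Fin.Properties as Finₚ
open import Data.Integer as ℤ using (ℤ)
import Data.Integer.Properties as ℤₚ
open import Data.List using (List; []; _∷_; _++_; map; filter; length; foldr; concatMap; applyUpTo;
  allFin; take; drop)
import Data.List.Properties as Listₚ
open import Data.List.Membership.DecPropositional as DecMembership using ()
open import Data.List.Membership.Propositional using (_∈_; _∉_; find; lose)
open import Data.List.Membership.Propositional.Properties using (∈-map⁺; ∈-map⁻; ∈-++⁺ˡ; ∈-++⁺ʳ;
  ∈-++⁻; ∈-concatMap⁺; ∈-concatMap⁻; ∈-filter⁺; ∈-filter⁻; ∈-upTo⁻; ∈-length)
open import Data.List.Membership.Propositional.Properties.WithK using (unique∧set⇒bag)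
open import Data.List.NonEmpty using () renaming (_∷_ to _◂_)
open import Data.List.Relation.Binary.BagAndSetEquality using (∼bag⇒↭)
open import Data.List.Relation.Binary.Permutation.Propositional.Properties using (↭-length)
open import Data.List.Relation.Unary.All as All using (All; []; _∷_)
import Data.List.Relation.Unary.All.Properties as Allₚ
open import Data.List.Relation.Unary.AllPairs using ([]; _∷_)
open import Data.List.Relation.Unary.Any using (here; there)
open import Data.List.Relation.Unary.Linked as Linked using (Linked; [-]; _∷_)
import Data.List.Relation.Unary.Linked.Properties as Linkedₚ
open import Data.List.Relation.Unary.Unique.Propositional using (Unique)
import Data.List.Relation.Unary.Unique.Propositional.Properties as Uniqueₚ
open import Data.Nat using (ℕ; zero; suc; _+_; _*_; _∸_; _^_; _⊔_; _≤_; _<_; z≤n; s≤s; _≟_; _≤?_;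
  _<?_)
open import Data.Nat.ListAction using (sum)
open import Data.Nat.Properties
open import Data.Nat.Tactic.RingSolver using (solve-∀)
open import Data.Product using (∃; ∃-syntax; _×_; _,_; proj₁; proj₂)
open import Data.Product.Relation.Binary.Lex.Strict using (×-Lex; ×-isStrictTotalOrder)
open import Data.Product.Relation.Binary.Pointwise.NonDependent using (Pointwise)
open import Data.Sum using (_⊎_; inj₁; inj₂)
import Data.Vec as Vec
open import Data.Vec using ([]; _∷_)
import Data.Vec.Properties as Vecₚ
open import Function using (_∘_; _⇔_; mk⇔; Equivalence)
open import Relation.Binary using (IsStrictTotalOrder; tri<; tri≈; tri>)
open import Relation.Binary.PropositionalEquality
open import Relation.Nullary using (¬_; Dec; yes; no; does)
open import Relation.Nullary.Decidable using (dec-true; dec-false; does-⇔; ¬?; _×-dec_)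
open import Relation.Unary using (Decidable)

open DecMembership _≟_ using (_∈?_)
open Equivalence

-- The initial diagrams are an obstacle: each comes with a peak composition of its own. When rows
-- increase and the shape is itself a peak composition, they only say that the entry in box (2, r)
-- is at most every entry in a higher row. In this form (`Closed`) condition (3) compares two boxes
-- at a time, and standardization preserves it because it is a comparison of keys.
--
-- The two counts at the end do not agree state by state. After a non-descent, a choice whose last
-- bit is b has, up to the power of 2 for later peaks, as many continuations as a marking whose last
-- mark is b. After a descent the last bit has no influence, and twice the number of choices equals
-- the sum of the numbers of markings over both marks. The induction carries whichever relation the
-- last position calls for.

-- Counting with enumerations

same-length : {A : Set} {xs ys : List A} → Unique xs → Unique ys →
              (∀ {x} → x ∈ xs → x ∈ ys) → (∀ {x} → x ∈ ys → x ∈ xs) → length xs ≡ length ys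
same-length u v f g = ↭-length (∼bag⇒↭ (unique∧set⇒bag u v (mk⇔ f g)))

-- Serves both monomial and fundamental quasisymmetric functions: at a fixed monomial each of them
-- has coefficient 0 or 1, so a sum of them counts the indices that hit.
∑-count : {A : Set} {P Q : A → Set} (E : Enumeration P) (f : A → Series) (e : Monomial)
          (Q? : Decidable Q) → (∀ {x} → P x → Q x → f x e ≡ ℤ.+ 1) →
          (∀ {x} → P x → ¬ Q x → f x e ≡ ℤ.0ℤ) →
          ∑ E f e ≡ ℤ.+ length (filter Q? (elements E))
∑-count {A} E f e Q? hit miss = go (elements E) (to (member E))
  where
  go : ∀ xs → (∀ {x} → x ∈ xs → _) →
       foldr (λ x s → f x e ℤ.+ s) ℤ.0ℤ xs ≡ ℤ.+ length (filter Q? xs)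
  go []       _ = refl
  go (x ∷ xs) P∈ with Q? x
  ... | yes q = cong₂ ℤ._+_ (hit (P∈ (here refl)) q) (go xs (P∈ ∘ there))
  ... | no ¬q = trans (cong₂ ℤ._+_ (miss (P∈ (here refl)) ¬q) (go xs (P∈ ∘ there))) (ℤₚ.+-identityˡ _)

∑-natural : {A : Set} {P : A → Set} (E : Enumeration P) (f : A → Series) (e : Monomial)
            (g : A → ℕ) → (∀ {x} → P x → f x e ≡ ℤ.+ g x) →
            ∑ E f e ≡ ℤ.+ sum (map g (elements E))
∑-natural {A} E f e g eq = go (elements E) (to (member E))
  where
  go : ∀ xs → (∀ {x} → x ∈ xs → _) →
       foldr (λ x s → f x e ℤ.+ s) ℤ.0ℤ xs ≡ ℤ.+ sum (map g xs)
  go []       _  = refl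
  go (x ∷ xs) P∈ = cong₂ ℤ._+_ (eq (P∈ (here refl))) (go xs (P∈ ∘ there))

map-unique : {A B : Set} (f : A → B) (xs : List A) → Unique xs →
             (∀ {x x′} → x ∈ xs → x′ ∈ xs → f x ≡ f x′ → x ≡ x′) → Unique (map f xs)
map-unique f []       []       inj = []
map-unique f (x ∷ xs) (x∉ ∷ u) inj =
  All.tabulate (λ y∈ → λ { refl → let (x′ , x′∈ , eq) = ∈-map⁻ f y∈
                                  in All.lookup x∉ x′∈ (inj (here refl) (there x′∈) eq) })
  ∷ map-unique f xs u (λ x∈ x′∈ → inj (there x∈) (there x′∈))

∑-zero : {A : Set} {P : A → Set} (E : Enumeration P) (f : A → Series) (e : Monomial) →
         (∀ {x} → P x → f x e ≡ ℤ.0ℤ) → ∑ E f e ≡ ℤ.0ℤ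
∑-zero {A} E f e vanish = trans (∑-count E f e none? (λ _ ()) (λ p _ → vanish p))
  (cong (ℤ.+_ ∘ length) (Listₚ.filter-none none? {elements E} (All.tabulate λ _ ())))
  where
  none? : Decidable {A = A} (λ _ → ⊥)
  none? _ = no λ ()

concatMap-unique : {A B : Set} (f : A → List B) (xs : List A) → Unique xs →
                   (∀ {x} → x ∈ xs → Unique (f x)) →
                   (∀ {x x′ y} → x ∈ xs → x′ ∈ xs → y ∈ f x → y ∈ f x′ → x ≡ x′) →
                   Unique (concatMap f xs)
concatMap-unique f []       _        uf sep = []
concatMap-unique f (x ∷ xs) (x∉ ∷ u) uf sep = Uniqueₚ.++⁺ (uf (here refl))
  (concatMap-unique f xs u (uf ∘ there) λ x∈ x′∈ → sep (there x∈) (there x′∈))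
  λ (y∈ , y∈′) → let (x′ , x′∈ , y∈″) = find (∈-concatMap⁻ f {xs = xs} y∈′)
                 in All.lookup x∉ x′∈ (sep (here refl) (there x′∈) y∈ y∈″)

length-concatMap : {A B : Set} (f : A → List B) (xs : List A) →
                   length (concatMap f xs) ≡ sum (map (length ∘ f) xs)
length-concatMap f []       = refl
length-concatMap f (x ∷ xs) = trans (Listₚ.length-++ (f x)) (cong (length (f x) +_) (length-concatMap f xs))

-- Coefficients of monomial quasisymmetric functions

flat : Monomial → List ℕ
flat = filter (0 <?_)

interval : ℕ → ℕ → List ℕ
interval k zero    = []
interval k (suc n) = suc k ∷ interval (suc k) n

1…≡interval : ∀ n → 1… n ≡ interval 0 n
1…≡interval n = go (λ i → i) 0 n λ _ → refl
  where
  go : ∀ f k n → (∀ i → f i ≡ k + i) → map suc (applyUpTo f n) ≡ interval k n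
  go f k zero    _  = refl
  go f k (suc n) eq = cong₂ _∷_ (cong suc (trans (eq 0) (+-identityʳ k)))
    (go (f ∘ suc) (suc k) n λ i → trans (eq (suc i)) (+-suc k i))

∈-1…⁻ : ∀ {i} n → i ∈ 1… n → 1 ≤ i × i ≤ n
∈-1…⁻ n i∈ with ∈-map⁻ suc i∈
... | j , j∈ , refl = s≤s z≤n , ∈-upTo⁻ j∈

exponent-below : ∀ is α {j} → All (j <_) is → exponent is α j ≡ 0
exponent-below []       []      _ = refl
exponent-below []       (a ∷ α) _ = refl
exponent-below (i ∷ is) []      _ = refl
exponent-below (i ∷ is) (a ∷ α) {j} (j<i ∷ j<is)
  rewrite dec-false (i ≟ j) (≢-sym (<⇒≢ j<i)) = exponent-below is α j<is

exponent-here : ∀ i is a α → exponent (i ∷ is) (a ∷ α) i ≡ a + exponent is α i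
exponent-here i is a α rewrite dec-true (i ≟ i) refl = refl

exponents-later : ∀ {i} is a α k n → i ≤ k →
                  map (exponent (i ∷ is) (a ∷ α)) (interval k n) ≡ map (exponent is α) (interval k n)
exponents-later is a α k zero    _   = refl
exponents-later {i} is a α k (suc n) i≤k rewrite dec-false (i ≟ suc k) (<⇒≢ (s≤s i≤k)) =
  cong (_ ∷_) (exponents-later is a α (suc k) n (m≤n⇒m≤1+n i≤k))

-- The only index sequence through which `e` can be a term of `M (flat e)`; `k` is the number of
-- variables already passed.
support : ℕ → Monomial → List ℕ
support k []          = []
support k (zero ∷ e)  = support (suc k) e
support k (suc x ∷ e) = suc k ∷ support (suc k) e

relink : ∀ {j k is} → j ≤ k → Linked _<_ (k ∷ is) → Linked _<_ (j ∷ is)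
relink j≤k [-]       = [-]
relink j≤k (k<i ∷ l) = ≤-<-trans j≤k k<i ∷ l

above : ∀ {k is} → Linked _<_ (k ∷ is) → All (k <_) is
above [-]       = []
above (k<i ∷ l) = Linkedₚ.Linked⇒All <-trans k<i l

support-linked : ∀ k e → Linked _<_ (k ∷ support k e)
support-linked k []          = [-]
support-linked k (zero ∷ e)  = relink (n≤1+n k) (support-linked (suc k) e)
support-linked k (suc x ∷ e) = n<1+n k ∷ support-linked (suc k) e

support-bounded : ∀ k e → All (_≤ k + length e) (support k e)
support-bounded k []          = []
support-bounded k (zero ∷ e)  = subst (λ m → All (_≤ m) (support (suc k) e))
  (sym (+-suc k (length e))) (support-bounded (suc k) e)
support-bounded k (suc x ∷ e) = subst (λ m → All (_≤ m) (suc k ∷ support (suc k) e))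
  (sym (+-suc k (length e)))
  (m≤m+n (suc k) (length e) ∷ support-bounded (suc k) e)

length-support : ∀ k e → length (support k e) ≡ length (flat e)
length-support k []          = refl
length-support k (zero ∷ e)  = length-support (suc k) e
length-support k (suc x ∷ e) = cong suc (length-support (suc k) e)

exponent-support : ∀ k e → map (exponent (support k e) (flat e)) (interval k (length e)) ≡ e
exponent-support k []          = refl
exponent-support k (zero ∷ e)  = cong₂ _∷_
  (exponent-below (support (suc k) e) (flat e) (above (support-linked (suc k) e)))
  (exponent-support (suc k) e)
exponent-support k (suc x ∷ e) = cong₂ _∷_
  (trans (exponent-here (suc k) (support (suc k) e) (suc x) (flat e))
    (trans (cong (suc x +_) (exponent-below (support (suc k) e) (flat e)
      (above (support-linked (suc k) e)))) (+-identityʳ _)))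
  (trans (exponents-later (support (suc k) e) (suc x) (flat e) (suc k) (length e) ≤-refl)
         (exponent-support (suc k) e))

-- Variable `suc k` is either the smallest index, and then its exponent is the head of `δ` because
-- the later indices are larger, or it lies below every index and has exponent 0. Positivity of `δ`
-- keeps the first case apart from the zeros that `flat` drops.
term-unique : ∀ k e δ is → All (0 <_) δ → length is ≡ length δ → Linked _<_ (k ∷ is) →
              All (_≤ k + length e) is → map (exponent is δ) (interval k (length e)) ≡ e →
              δ ≡ flat e × is ≡ support k e
term-unique k []      []      []       _ _ _ _ _ = refl , refl
term-unique k []      (a ∷ δ) (i ∷ is) _ _ (k<i ∷ _) (i≤k ∷ _) _ =
  ⊥-elim (<⇒≱ k<i (subst (i ≤_) (+-identityʳ k) i≤k))
term-unique k (x ∷ e) []      []       _ _ _ _ eq with Listₚ.∷-injective eq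
... | refl , eq′ = term-unique (suc k) e [] [] [] refl [-] [] eq′
term-unique k (x ∷ e) (a ∷ δ) (i ∷ is) (0<a ∷ pos) len l@(k<i ∷ l′) (i≤ ∷ is≤) eq
  with Listₚ.∷-injective eq | suc k ≟ i
... | eq₀ , eq′ | yes refl with trans (sym eq₀) (trans (exponent-here i is a δ)
         (trans (cong (a +_) (exponent-below is δ (above l′))) (+-identityʳ a)))
term-unique k (x ∷ e) (suc a ∷ δ) (i ∷ is) (0<a ∷ pos) len l@(k<i ∷ l′) (i≤ ∷ is≤) eq
  | eq₀ , eq′ | yes refl | refl
  with term-unique (suc k) e δ is pos (suc-injective len) l′
        (subst (λ m → All (_≤ m) is) (+-suc k (length e)) is≤)
        (trans (sym (exponents-later is x δ (suc k) (length e) ≤-refl)) eq′)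
... | p , q = cong (x ∷_) p , cong (suc k ∷_) q
term-unique k (x ∷ e) (a ∷ δ) (i ∷ is) (0<a ∷ pos) len l@(k<i ∷ l′) (i≤ ∷ is≤) eq | eq₀ , eq′ | no k+1≢i
  with trans (sym eq₀) (exponent-below (i ∷ is) (a ∷ δ) (above (≤∧≢⇒< k<i k+1≢i ∷ l′)))
... | refl = term-unique (suc k) e (a ∷ δ) (i ∷ is) (0<a ∷ pos) len (≤∧≢⇒< k<i k+1≢i ∷ l′)
               (subst (λ m → All (_≤ m) (i ∷ is)) (+-suc k (length e)) (i≤ ∷ is≤)) eq′

MTerm⇒ : ∀ {δ e is} → All (0 <_) δ → MTerm δ e is → δ ≡ flat e × is ≡ support 0 e
MTerm⇒ {δ} {e} {is} pos (len , linked , bounds , eq) = term-unique 0 e δ is pos len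
  (link is linked (All.map (proj₁ ∘ ∈-1…⁻ (length e)) bounds))
  (All.map (proj₂ ∘ ∈-1…⁻ (length e)) bounds)
  (subst (λ r → map (exponent is δ) r ≡ e) (1…≡interval (length e)) eq)
  where
  link : ∀ is → Linked _<_ is → All (1 ≤_) is → Linked _<_ (0 ∷ is)
  link []      _ _       = [-]
  link (i ∷ _) l (p ∷ _) = p ∷ l

⇒MTerm : ∀ e → MTerm (flat e) e (support 0 e)
⇒MTerm e = length-support 0 e , Linked.tail (support-linked 0 e)
  , All.zipWith (λ (p , q) → ∈-1… p q) (above (support-linked 0 e) , support-bounded 0 e)
  , subst (λ r → map (exponent (support 0 e) (flat e)) r ≡ e) (sym (1…≡interval (length e)))
      (exponent-support 0 e)

M-hit : ∀ {δ} e → All (0 <_) δ → δ ≡ flat e → M δ e ≡ ℤ.+ 1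
M-hit e pos refl = cong ℤ.+_ (same-length {ys = support 0 e ∷ []} (unique (M-terms (flat e) e)) ([] ∷ [])
  (λ is∈ → here (proj₂ (MTerm⇒ {e = e} pos (to (member (M-terms (flat e) e)) is∈))))
  (λ { (here refl) → from (member (M-terms (flat e) e)) (⇒MTerm e) }))

M-miss : ∀ {δ} e → All (0 <_) δ → δ ≢ flat e → M δ e ≡ ℤ.0ℤ
M-miss {δ} e pos δ≢ = cong ℤ.+_ (same-length {ys = []} (unique (M-terms δ e)) []
  (λ is∈ → ⊥-elim (δ≢ (proj₁ (MTerm⇒ {e = e} pos (to (member (M-terms δ e)) is∈)))))
  (λ ()))

-- Compositions as bit words

-- The default is false, so that positions beyond the word are never elements of the set it
-- describes.
at : List Bool → ℕ → Bool
at []       _       = false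
at (b ∷ bs) zero    = b
at (b ∷ bs) (suc j) = at bs j

at-ext : ∀ w w′ → length w ≡ length w′ → (∀ j → j < length w → at w j ≡ at w′ j) → w ≡ w′
at-ext []      []        _   _  = refl
at-ext (b ∷ w) (b′ ∷ w′) len eq = cong₂ _∷_ (eq 0 (s≤s z≤n))
  (at-ext w w′ (suc-injective len) λ j j< → eq (suc j) (s≤s j<))

-- The bijection between subsets of [n - 1] and compositions of n. A subset is its indicator word of
-- length n - 1, with bit `j` standing for the element `suc j`.
decode : List Bool → List ℕ
decode []           = 1 ∷ []
decode (true  ∷ bs) = 1 ∷ decode bs
decode (false ∷ bs) = increment (decode bs)

decode-cons : ∀ bs → ∃[ a ] ∃[ α ] decode bs ≡ suc a ∷ α
decode-cons []           = 0 , [] , refl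
decode-cons (true ∷ bs)  = 0 , decode bs , refl
decode-cons (false ∷ bs) with decode bs | decode-cons bs
... | _ | a , α , refl = suc a , α , refl

decode-⊨ : ∀ bs → decode bs ⊨ suc (length bs)
decode-⊨ []           = s≤s z≤n ∷ [] , refl
decode-⊨ (true ∷ bs)  = s≤s z≤n ∷ proj₁ (decode-⊨ bs) , cong suc (proj₂ (decode-⊨ bs))
decode-⊨ (false ∷ bs) with decode bs | decode-cons bs | decode-⊨ bs
... | _ | a , α , refl | _ ∷ pos , eq = s≤s z≤n ∷ pos , cong suc eq

encode : ∀ n {β} → β ⊨ suc n → ∃[ bs ] length bs ≡ n × decode bs ≡ β
encode n       {[]}                (_ , ())
encode n       {zero ∷ β}          (() ∷ _ , _)
encode zero    {suc zero ∷ []}     _               = [] , refl , refl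
encode zero    {suc zero ∷ zero ∷ β} (_ ∷ () ∷ _ , _)
encode zero    {suc (suc a) ∷ β}   (_ , ())
encode (suc n) {suc zero ∷ β}      (_ ∷ pos , eq)  with encode n (pos , suc-injective eq)
... | bs , refl , refl = true ∷ bs , refl , refl
encode (suc n) {suc (suc a) ∷ β}   (_ ∷ pos , eq)
  with encode n {suc a ∷ β} (s≤s z≤n ∷ pos , suc-injective eq)
... | bs , refl , eq′ = false ∷ bs , refl , cong increment eq′

decode-injective : ∀ bs bs′ → length bs ≡ length bs′ → decode bs ≡ decode bs′ → bs ≡ bs′
decode-injective []           []            _   _  = refl
decode-injective (true ∷ bs)  (true ∷ bs′)  len eq =
  cong (true ∷_) (decode-injective bs bs′ (suc-injective len) (Listₚ.∷-injectiveʳ eq))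
decode-injective (true ∷ bs)  (false ∷ bs′) len eq with decode bs′ | decode-cons bs′
decode-injective (true ∷ bs)  (false ∷ bs′) len () | _ | a , α , refl
decode-injective (false ∷ bs) (true ∷ bs′)  len eq with decode bs | decode-cons bs
decode-injective (false ∷ bs) (true ∷ bs′)  len () | _ | a , α , refl
decode-injective (false ∷ bs) (false ∷ bs′) len eq =
  cong (false ∷_) (decode-injective bs bs′ (suc-injective len) (uninc (decode bs) (decode bs′) eq))
  where
  uninc : ∀ β β′ → increment β ≡ increment β′ → β ≡ β′
  uninc []      []       _    = refl
  uninc (_ ∷ _) (_ ∷ _) refl = refl

set-∷ : ∀ a bs → set (a ∷ decode bs) ≡ a ∷ map (a +_) (set (decode bs))
set-∷ a bs with decode bs | decode-cons bs
... | _ | _ , _ , refl = refl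

set-increment : ∀ bs → set (increment (decode bs)) ≡ map suc (set (decode bs))
set-increment bs with decode bs | decode-cons bs
... | _ | a , []    , refl = refl
... | _ | a , b ∷ α , refl = cong (suc (suc a) ∷_) (Listₚ.map-∘ (set (b ∷ α)))

∈-set⇒ : ∀ bs {i} → i ∈ set (decode bs) → ∃[ j ] i ≡ suc j × at bs j ≡ true
∈-set⇒ (true ∷ bs) i∈ with subst (_ ∈_) (set-∷ 1 bs) i∈
... | here refl = 0 , refl , refl
... | there i∈′ with ∈-map⁻ suc i∈′
...   | _ , i∈″ , refl with ∈-set⇒ bs i∈″
...     | j , refl , eq = suc j , refl , eq
∈-set⇒ (false ∷ bs) i∈ with ∈-map⁻ suc (subst (_ ∈_) (set-increment bs) i∈)
... | _ , i∈″ , refl with ∈-set⇒ bs i∈″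
...   | j , refl , eq = suc j , refl , eq

⇒∈-set : ∀ bs j → at bs j ≡ true → suc j ∈ set (decode bs)
⇒∈-set (true ∷ bs)  zero    _  = subst (1 ∈_) (sym (set-∷ 1 bs)) (here refl)
⇒∈-set (true ∷ bs)  (suc j) eq = subst (suc (suc j) ∈_) (sym (set-∷ 1 bs))
  (there (∈-map⁺ suc (⇒∈-set bs j eq)))
⇒∈-set (false ∷ bs) (suc j) eq = subst (suc (suc j) ∈_) (sym (set-increment bs))
  (∈-map⁺ suc (⇒∈-set bs j eq))

refines-∷ : ∀ {γ β} a → γ Refines β → (a ∷ γ) Refines (a ∷ β)
refines-∷ a (blocks , refl , refl) = (a ◂ []) ∷ blocks , refl , cong (_∷ _) (+-identityʳ a)

refines-join : ∀ {γ β} a b → γ Refines (b ∷ β) → (a ∷ γ) Refines (a + b ∷ β)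
refines-join a b ((x ◂ xs) ∷ blocks , refl , refl) = (a ◂ (x ∷ xs)) ∷ blocks , refl , refl

refines-suc : ∀ {γ β} g b → (g ∷ γ) Refines (b ∷ β) → (suc g ∷ γ) Refines (suc b ∷ β)
refines-suc g b ((.g ◂ xs) ∷ blocks , refl , refl) = (suc g ◂ xs) ∷ blocks , refl , refl

-- Refinement is inclusion of the sets of partial sums. The three compatible pairs of first letters
-- are three ways to extend the blocks: a new block `1`, a new entry `1` in front of the first
-- block, or an increase of the first entry.
below⇒refines : ∀ es bs → length es ≡ length bs → (∀ j → at bs j ≡ true → at es j ≡ true) →
                decode es Refines decode bs
below⇒refines []           []           _   _  = (1 ◂ []) ∷ [] , refl , refl
below⇒refines (true ∷ es)  (true ∷ bs)  len le =
  refines-∷ 1 (below⇒refines es bs (suc-injective len) (le ∘ suc))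
below⇒refines (true ∷ es)  (false ∷ bs) len le
  with decode bs | decode-cons bs | below⇒refines es bs (suc-injective len) (le ∘ suc)
... | _ | b , _ , refl | r = refines-join 1 (suc b) r
below⇒refines (false ∷ es) (false ∷ bs) len le
  with decode es | decode-cons es | decode bs | decode-cons bs
     | below⇒refines es bs (suc-injective len) (le ∘ suc)
... | _ | g , _ , refl | _ | b , _ , refl | r = refines-suc (suc g) (suc b) r
below⇒refines (false ∷ es) (true ∷ bs) len le with le 0 refl
... | ()

unrefines-∷ : ∀ {γ β} → All (0 <_) γ → (1 ∷ γ) Refines (1 ∷ β) → γ Refines β
unrefines-∷ pos ((.1 ◂ []) ∷ blocks , refl , refl) = blocks , refl , refl
-- A longer first block with sum 1 would contain a zero.
unrefines-∷ (0<y ∷ _) ((.1 ◂ (y ∷ ys)) ∷ blocks , refl , eq) =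
  ⊥-elim (<⇒≢ 0<y (sym (m+n≡0⇒m≡0 y (suc-injective (Listₚ.∷-injectiveˡ eq)))))

unrefines-join : ∀ {γ β} b → (1 ∷ γ) Refines (suc (suc b) ∷ β) → γ Refines (suc b ∷ β)
unrefines-join b ((.1 ◂ []) ∷ blocks , refl , ())
unrefines-join b ((.1 ◂ (y ∷ ys)) ∷ blocks , refl , eq) =
  (y ◂ ys) ∷ blocks , refl ,
  cong₂ _∷_ (suc-injective (Listₚ.∷-injectiveˡ eq)) (Listₚ.∷-injectiveʳ eq)

unrefines-suc : ∀ {γ β} g b → (suc g ∷ γ) Refines (suc b ∷ β) → (g ∷ γ) Refines (b ∷ β)
unrefines-suc g b ((.(suc g) ◂ xs) ∷ blocks , refl , refl) = (g ◂ xs) ∷ blocks , refl , refl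

refines⇒below : ∀ es bs → length es ≡ length bs → decode es Refines decode bs →
                ∀ j → at bs j ≡ true → at es j ≡ true
refines⇒below (true ∷ es)  (true ∷ bs)  len r zero    _  = refl
refines⇒below (true ∷ es)  (true ∷ bs)  len r (suc j) eq =
  refines⇒below es bs (suc-injective len) (unrefines-∷ (proj₁ (decode-⊨ es)) r) j eq
refines⇒below (true ∷ es)  (false ∷ bs) len r (suc j) eq
  with decode bs | decode-cons bs | refines⇒below es bs (suc-injective len)
... | _ | b , _ , refl | ih = ih (unrefines-join b r) j eq
refines⇒below (false ∷ es) (false ∷ bs) len r (suc j) eq
  with decode es | decode-cons es | decode bs | decode-cons bs | refines⇒below es bs (suc-injective len)
... | _ | g , _ , refl | _ | b , _ , refl | ih = ih (unrefines-suc (suc g) (suc b) r) j eq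
refines⇒below (false ∷ es) (true ∷ bs)  len r j eq with decode es | decode-cons es
refines⇒below (false ∷ es) (true ∷ bs)  len ((.(suc (suc g)) ◂ xs) ∷ blocks , refl , ()) j eq
  | _ | g , _ , refl

-- Transfer matrices

when : {A : Set} → Bool → List A → List A
when b xs = if b then xs else []

∈-when⁺ : {A : Set} {x : A} {xs : List A} {b : Bool} → b ≡ true → x ∈ xs → x ∈ when b xs
∈-when⁺ refl x∈ = x∈

∈-when⁻ : {A : Set} {x : A} {xs : List A} (b : Bool) → x ∈ when b xs → b ≡ true × x ∈ xs
∈-when⁻ true x∈ = refl , x∈

-- The letter before position 0 is taken to be b.
paths : (ok : ℕ → Bool → Bool → Bool) → Bool → ℕ → List (List Bool)
paths ok b zero    = [] ∷ []
paths ok b (suc n) = when (ok 0 b true)  (map (true ∷_)  (paths (ok ∘ suc) true n))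
                  ++ when (ok 0 b false) (map (false ∷_) (paths (ok ∘ suc) false n))

count : (ok : ℕ → Bool → Bool → Bool) → Bool → ℕ → ℕ
count ok b zero    = 1
count ok b (suc n) = (if ok 0 b true  then count (ok ∘ suc) true n  else 0)
                   + (if ok 0 b false then count (ok ∘ suc) false n else 0)

length-when : {A : Set} {xs : List A} {k : ℕ} (b : Bool) → length xs ≡ k →
              length (when b xs) ≡ (if b then k else 0)
length-when true  eq = eq
length-when false eq = refl

length-paths : ∀ ok b n → length (paths ok b n) ≡ count ok b n
length-paths ok b zero    = refl
length-paths ok b (suc n) = trans
  (Listₚ.length-++ (when (ok 0 b true) (map (true ∷_) (paths (ok ∘ suc) true n))))
  (cong₂ _+_ (half true) (half false))
  where
  half : ∀ b′ → length (when (ok 0 b b′) (map (b′ ∷_) (paths (ok ∘ suc) b′ n)))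
              ≡ (if ok 0 b b′ then count (ok ∘ suc) b′ n else 0)
  half b′ = length-when (ok 0 b b′)
    (trans (Listₚ.length-map (b′ ∷_) (paths (ok ∘ suc) b′ n)) (length-paths (ok ∘ suc) b′ n))

IsPath : (ok : ℕ → Bool → Bool → Bool) → Bool → ℕ → List Bool → Set
IsPath ok b n w = length w ≡ n × (∀ j → j < n → ok j (at (b ∷ w) j) (at w j) ≡ true)

∈-paths : ∀ ok b n {w} → w ∈ paths ok b n ⇔ IsPath ok b n w
∈-paths ok b n = mk⇔ (sound ok b n) (complete ok b n _)
  where
  prepend : ∀ {ok b n w ws} b′ → (∀ {v} → v ∈ ws → IsPath (ok ∘ suc) b′ n v) →
            w ∈ when (ok 0 b b′) (map (b′ ∷_) ws) → IsPath ok b (suc n) w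
  prepend {ok} {b} b′ tails w∈ with ∈-when⁻ (ok 0 b b′) w∈
  ... | ok₀ , w∈′ with ∈-map⁻ (b′ ∷_) w∈′
  ...   | v , v∈ , refl with tails v∈
  ...     | len , oks = cong suc len , λ { zero _ → ok₀ ; (suc j) (s≤s j<n) → oks j j<n }

  sound : ∀ ok b n {w} → w ∈ paths ok b n → IsPath ok b n w
  sound ok b zero    (here refl) = refl , λ _ ()
  sound ok b (suc n) {w} w∈
    with ∈-++⁻ (when (ok 0 b true) (map (true ∷_) (paths (ok ∘ suc) true n))) w∈
  ... | inj₁ w∈₁ = prepend {ok} {b} true  (sound (ok ∘ suc) true n)  w∈₁
  ... | inj₂ w∈₂ = prepend {ok} {b} false (sound (ok ∘ suc) false n) w∈₂
  complete : ∀ ok b n w → IsPath ok b n w → w ∈ paths ok b n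
  complete ok b zero    []          _           = here refl
  complete ok b (suc n) (true ∷ w)  (len , oks) = ∈-++⁺ˡ (∈-when⁺ (oks 0 (s≤s z≤n))
    (∈-map⁺ (true ∷_) (complete (ok ∘ suc) true n w (suc-injective len , λ j j<n → oks (suc j) (s≤s j<n)))))
  complete ok b (suc n) (false ∷ w) (len , oks) =
    ∈-++⁺ʳ (when (ok 0 b true) (map (true ∷_) (paths (ok ∘ suc) true n))) (∈-when⁺ (oks 0 (s≤s z≤n))
    (∈-map⁺ (false ∷_) (complete (ok ∘ suc) false n w (suc-injective len , λ j j<n → oks (suc j) (s≤s j<n)))))

paths-unique : ∀ ok b n → Unique (paths ok b n)
paths-unique ok b zero    = [] ∷ []
paths-unique ok b (suc n) = Uniqueₚ.++⁺ (half true) (half false) λ (t∈ , f∈) →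
  disjoint (proj₂ (∈-when⁻ (ok 0 b true) t∈)) (proj₂ (∈-when⁻ (ok 0 b false) f∈))
  where
  unique-when : ∀ b′ {xs : List (List Bool)} → Unique xs → Unique (when b′ xs)
  unique-when true  u = u
  unique-when false u = []
  half : ∀ b′ → Unique (when (ok 0 b b′) (map (b′ ∷_) (paths (ok ∘ suc) b′ n)))
  half b′ = unique-when (ok 0 b b′) (Uniqueₚ.map⁺ Listₚ.∷-injectiveʳ (paths-unique (ok ∘ suc) b′ n))
  disjoint : ∀ {w xs ys} → w ∈ map (true ∷_) xs → ¬ w ∈ map (false ∷_) ys
  disjoint t∈ f∈ with ∈-map⁻ (true ∷_) t∈ | ∈-map⁻ (false ∷_) f∈
  ... | _ , _ , refl | _ , _ , ()

-- Which marks may be carried by consecutive entries j, j + 1 of a standard tableau, where d tells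
-- whether j is a descent and e whether the value changes between them (true stands for marked).
allowed : (d e m m′ : Bool) → Bool
allowed d true  _     _     = true
allowed d false true  true  = d
allowed d false true  false = true
allowed d false false true  = false
allowed d false false false = not d

-- The first entry has no predecessor and may carry either mark; step `suc j` compares the letters
-- `j` and `suc j`.
markOK : (d e : ℕ → Bool) → ℕ → Bool → Bool → Bool
markOK d e zero    _ _  = true
markOK d e (suc j) m m′ = allowed (d j) (e j) m m′

markings : (d e : ℕ → Bool) → ℕ → List (List Bool)
markings d e m = paths (markOK d e) true (suc m)

isPeak : Bool → Bool → Bool
isPeak d⁻ d = d ∧ not d⁻

-- b and b⁻ tell whether j and j ∸ 1 lie in set(β), and e whether j lies in set(γ).
choiceOK : (d⁻ d e b⁻ b : Bool) → Bool
choiceOK d⁻ d e b⁻ b = (not b ∨ e) ∧ (not (isPeak d⁻ d) ∨ (b xor b⁻))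

peaks : (d⁻ d : ℕ → Bool) → ℕ → ℕ
peaks d⁻ d zero    = 0
peaks d⁻ d (suc m) = (if isPeak (d⁻ 0) (d 0) then 1 else 0) + peaks (d⁻ ∘ suc) (d ∘ suc) m

-- The relation between 2^p times the number of choices after b⁻ = true, false (xt, xf) and the
-- number of markings after a marked or unmarked letter (gt, gf).
Transfer : (d⁻ : Bool) (xt xf gt gf : ℕ) → Set
Transfer true  xt xf gt gf = (xt * 2 ≡ gt + gf) × (xf * 2 ≡ gt + gf)
Transfer false xt xf gt gf = (xt ≡ gt) × (xf ≡ gf)

-- After a descent the position is no peak, so `b⁻` has no influence and both numbers of choices
-- coincide. At a peak, `b` must be the negation of `b⁻`; the factor 2 contributed by the peak turns
-- the one surviving count into the sum `gt + gf`, since a descent comes next in `Transfer`. At a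
-- non-descent, `b` and the next mark are both free if `e` holds and both forced to be false
-- otherwise.
transfer-step : ∀ d⁻ d e p ct cf gt gf → Transfer d (2 ^ p * ct) (2 ^ p * cf) gt gf →
  let choose b⁻ = 2 ^ ((if isPeak d⁻ d then 1 else 0) + p)
                * ((if choiceOK d⁻ d e b⁻ true then ct else 0) + (if choiceOK d⁻ d e b⁻ false then cf else 0))
      mark m = (if allowed d e m true then gt else 0) + (if allowed d e m false then gf else 0)
  in Transfer d⁻ (choose true) (choose false) (mark true) (mark false)
transfer-step true true false p ct cf gt gf (t , f) =
  trans f (sym (+-identityʳ (gt + gf))) , trans f (sym (+-identityʳ (gt + gf)))
transfer-step true true true p ct cf gt gf (t , f) = eq , eq
  where
  eq : 2 ^ p * (ct + cf) * 2 ≡ gt + gf + (gt + gf)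
  eq = trans (cong (_* 2) (*-distribˡ-+ (2 ^ p) ct cf))
       (trans (*-distribʳ-+ 2 (2 ^ p * ct) (2 ^ p * cf)) (cong₂ _+_ t f))
transfer-step true false false p ct cf gt gf (refl , refl) = double (2 ^ p * cf) , double (2 ^ p * cf)
  where
  double : ∀ x → x * 2 ≡ x + x
  double = solve-∀
transfer-step true false true p ct cf gt gf (refl , refl) = eq (2 ^ p) ct cf , eq (2 ^ p) ct cf
  where
  eq : ∀ q c c′ → q * (c + c′) * 2 ≡ q * c + q * c′ + (q * c + q * c′)
  eq = solve-∀
-- Outside set(γ) the bit `b` is false, so the peak requires `b⁻` to be true. Likewise an unmarked
-- letter cannot be followed within its part across a descent: both counts for false vanish.
transfer-step false true false p ct cf gt gf (t , f) =
  trans (eq (2 ^ p) cf) f , *-zeroʳ (2 ^ suc p)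
  where
  eq : ∀ q c → 2 * q * c ≡ q * c * 2
  eq = solve-∀
transfer-step false true true p ct cf gt gf (t , f) =
  trans (eq (2 ^ p) cf) f , trans (eq′ (2 ^ p) ct) t
  where
  eq : ∀ q c → 2 * q * c ≡ q * c * 2
  eq = solve-∀
  eq′ : ∀ q c → 2 * q * (c + 0) ≡ q * c * 2
  eq′ = solve-∀
transfer-step false false false p ct cf gt gf (t , f) = f , f
transfer-step false false true p ct cf gt gf (refl , refl) =
  *-distribˡ-+ (2 ^ p) ct cf , *-distribˡ-+ (2 ^ p) ct cf

-- `d⁻` is a function of its own, tied to `d` by the hypothesis on shifts, so that the induction can
-- drop the first position of both.
transfer : ∀ m (d⁻ d e : ℕ → Bool) → (∀ j → d⁻ (suc j) ≡ d j) →
  let choose b⁻ = 2 ^ peaks d⁻ d m * count (λ j → choiceOK (d⁻ j) (d j) (e j)) b⁻ m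
      mark m₀   = count (λ j → allowed (d j) (e j)) m₀ m
  in Transfer (d⁻ 0) (choose true) (choose false) (mark true) (mark false)
transfer zero    d⁻ d e shift with d⁻ 0
... | true  = refl , refl
... | false = refl , refl
transfer (suc m) d⁻ d e shift = transfer-step (d⁻ 0) (d 0) (e 0) (peaks (d⁻ ∘ suc) (d ∘ suc) m)
  (choose true) (choose false) (mark true) (mark false)
  (subst (λ b → Transfer b (2^p * choose true) (2^p * choose false) (mark true) (mark false)) (shift 0)
    (transfer m (d⁻ ∘ suc) (d ∘ suc) (e ∘ suc) (shift ∘ suc)))
  where
  2^p       = 2 ^ peaks (d⁻ ∘ suc) (d ∘ suc) m
  choose    = λ b⁻ → count (λ j → choiceOK (d⁻ (suc j)) (d (suc j)) (e (suc j))) b⁻ m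
  mark      = λ m₀ → count (λ j → allowed (d (suc j)) (e (suc j))) m₀ m

preceded : Bool → (ℕ → Bool) → ℕ → Bool
preceded b d zero    = b
preceded b d (suc j) = d j

-- Position 0 is treated as following a descent because 1 is never a peak; the initial letter false
-- says that 0 is not in set(β).
choices : (d e : ℕ → Bool) → ℕ → List (List Bool)
choices d e = paths (λ j → choiceOK (preceded true d j) (d j) (e j)) false

-- The extra factor 2 comes from the free mark of the first entry: with position 0 treated as
-- following a descent, `Transfer` equates twice the number of choices with the sum over both first
-- marks.
choices-markings : ∀ (d e : ℕ → Bool) m → 2 ^ (peaks (preceded true d) d m + 1) * length (choices d e m)
                           ≡ length (markings d e m)
choices-markings d e m = begin
  2 ^ (p + 1) * length (choices d e m)     ≡⟨ cong (2 ^ (p + 1) *_) (length-paths _ false m) ⟩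
  2 ^ (p + 1) * c                          ≡⟨ cong (_* c) (^-distribˡ-+-* 2 p 1) ⟩
  2 ^ p * 2 * c                            ≡⟨ rotate (2 ^ p) c ⟩
  2 ^ p * c * 2                            ≡⟨ proj₂ (transfer m (preceded true d) d e (λ _ → refl)) ⟩
  count (λ j → allowed (d j) (e j)) true m + count (λ j → allowed (d j) (e j)) false m
                                           ≡⟨ sym (length-paths (markOK d e) true (suc m)) ⟩
  length (markings d e m)                  ∎
  where
  open ≡-Reasoning
  p = peaks (preceded true d) d m
  c = count (λ j → choiceOK (preceded true d j) (d j) (e j)) false m
  rotate : ∀ q c → q * 2 * c ≡ q * c * 2
  rotate = solve-∀

-- Coefficients of peak functions

witness : {P : Set} (p? : Dec P) → does p? ≡ true → P
witness (yes p) _ = p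

refutation : {P : Set} (p? : Dec P) → does p? ≡ false → ¬ P
refutation (no ¬p) _ = ¬p

interval-linked : ∀ k n → Linked _<_ (k ∷ interval k n)
interval-linked k zero    = [-]
interval-linked k (suc n) = n<1+n k ∷ interval-linked (suc k) n

1…-linked : ∀ n → Linked _<_ (1… n)
1…-linked n = subst (Linked _<_) (sym (1…≡interval n)) (Linked.tail (interval-linked 0 n))

-- `K` takes the peaks of a composition whose set already consists of peaks. The predecessor of a
-- peak is missing from `X`, hence also from `Peak X`.
Peak-idem : ∀ X → Peak (Peak X) ≡ Peak X
Peak-idem X = Listₚ.filter-all _ (All.tabulate λ i∈ →
  let (_ , i-1∉ , i≢1) = ∈-filter⁻ _ {xs = X} i∈
  in (λ i-1∈ → i-1∉ (proj₁ (∈-filter⁻ _ {xs = X} i-1∈))) , i≢1)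

-- comp n (x ∷ xs) = x ∷ rest n x xs; the local function of comp is not accessible by name.
rest : ℕ → ℕ → List ℕ → List ℕ
rest n x xs = drop 1 (comp n (x ∷ xs))

set-∷-rest : ∀ a n y ys → set (a ∷ rest n y ys) ≡ a ∷ map (a +_) (set (rest n y ys))
set-∷-rest a n y []       = refl
set-∷-rest a n y (_ ∷ _) = refl

set-rest : ∀ n x xs → Linked _<_ (x ∷ xs) → map (x +_) (set (rest n x xs)) ≡ xs
set-rest n x []       _         = refl
set-rest n x (y ∷ ys) (x<y ∷ l) = begin
  map (x +_) (set ((y ∸ x) ∷ rest n y ys))  ≡⟨ cong (map (x +_)) (set-∷-rest (y ∸ x) n y ys) ⟩
  x + (y ∸ x) ∷ map (x +_) (map (y ∸ x +_) S) ≡⟨ cong₂ _∷_ x+y∸x (sym (Listₚ.map-∘ S)) ⟩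
  y ∷ map (λ s → x + (y ∸ x + s)) S         ≡⟨ cong (y ∷_) (Listₚ.map-cong (λ s →
                                                trans (sym (+-assoc x (y ∸ x) s)) (cong (_+ s) x+y∸x)) S) ⟩
  y ∷ map (y +_) S                          ≡⟨ cong (y ∷_) (set-rest n y ys l) ⟩
  y ∷ ys                                    ∎
  where
  open ≡-Reasoning
  S = set (rest n y ys)
  x+y∸x = m+[n∸m]≡n (<⇒≤ x<y)

set-comp : ∀ n X → Linked _<_ X → set (comp n X) ≡ X
set-comp n []       _ = refl
set-comp n (x ∷ xs) l = trans (set-∷-rest x n x xs) (cong (x ∷_) (set-rest n x xs l))

sum-rest : ∀ n x xs → Linked _<_ (x ∷ xs) → All (_≤ n) (x ∷ xs) → x + sum (rest n x xs) ≡ n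
sum-rest n x []       _         (x≤n ∷ []) = trans (cong (x +_) (+-identityʳ (n ∸ x))) (m+[n∸m]≡n x≤n)
sum-rest n x (y ∷ ys) (x<y ∷ l) (_ ∷ ≤n)   =
  trans (sym (+-assoc x (y ∸ x) (sum (rest n y ys))))
    (trans (cong (_+ sum (rest n y ys)) (m+[n∸m]≡n (<⇒≤ x<y))) (sum-rest n y ys l ≤n))

sum-comp : ∀ n X → Linked _<_ X → All (_≤ n) X → sum (comp n X) ≡ n
sum-comp n []       _ _  = +-identityʳ n
sum-comp n (x ∷ xs) l ≤n = sum-rest n x xs l ≤n

-- The two predicates are known only through their truth values. Indices enter by equations because
-- `suc (k + j)` changes form when the interval is shifted.
length-filter-peaks : {Q R : ℕ → Set} (Q? : Decidable Q) (R? : Decidable R) (d⁻ d : ℕ → Bool) → ∀ k n →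
  (∀ i j → i ≡ suc (k + j) → does (Q? i) ≡ d j) →
  (∀ i j → i ≡ suc (k + j) → j < n → does (R? i) ≡ not (d⁻ j)) →
  length (filter R? (filter Q? (interval k n))) ≡ peaks d⁻ d n
length-filter-peaks Q? R? d⁻ d k zero    hQ hR = refl
length-filter-peaks Q? R? d⁻ d k (suc n) hQ hR
  with does (Q? (suc k)) | hQ (suc k) 0 (cong suc (sym (+-identityʳ k)))
     | length-filter-peaks Q? R? (d⁻ ∘ suc) (d ∘ suc) (suc k) n
         (λ i j eq → hQ i (suc j) (trans eq (cong suc (sym (+-suc k j)))))
         (λ i j eq j<n → hR i (suc j) (trans eq (cong suc (sym (+-suc k j)))) (s≤s j<n))
... | false | eq | ih rewrite sym eq = ih
... | true  | eq | ih rewrite sym eq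
  with does (R? (suc k)) | d⁻ 0 | hR (suc k) 0 (cong suc (sym (+-identityʳ k))) (s≤s z≤n)
...   | true  | false | _ = cong suc ih
...   | false | true  | _ = ih

-- A tableau enters its peak function only through its descent set, so an arbitrary decidable set
-- `Q` takes the place of the descents.
module _ {Q : ℕ → Set} (Q? : Decidable Q) (m : ℕ) where

  private
    X : List ℕ
    X = filter Q? (1… m)

    d : ℕ → Bool
    d j = does (Q? (suc j))

  length-Peak : length (Peak X) ≡ peaks (preceded true d) d m
  length-Peak = trans (cong (length ∘ filter peak? ∘ filter Q?) (1…≡interval m))
    (length-filter-peaks Q? peak? (preceded true d) d 0 m (λ { _ _ refl → refl }) predecessor)
    where
    peak? : Decidable (λ i → ¬ i ∸ 1 ∈ X × ¬ i ≡ 1)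
    peak? i = ¬? (i ∸ 1 ∈? X) ×-dec ¬? (i ≟ 1)
    predecessor : ∀ i j → i ≡ suc j → j < m → does (peak? i) ≡ not (preceded true d j)
    predecessor _ zero    refl _   = ∧-zeroʳ _
    predecessor _ (suc j) refl j<m = trans (∧-identityʳ _) (cong not
      (does-⇔ (mk⇔ (λ j∈ → proj₂ (∈-filter⁻ Q? {xs = 1… m} j∈))
                   (λ q → ∈-filter⁺ Q? (∈-1… (s≤s z≤n) (<⇒≤ j<m)) q)) (suc j ∈? X) (Q? (suc j))))

  ∈-Peak⁻ : ∀ {i} → i ∈ Peak X → ∃[ j ] i ≡ suc j × j < m × d j ≡ true × preceded true d j ≡ false
  ∈-Peak⁻ i∈ with ∈-filter⁻ _ {xs = X} i∈
  ... | i∈X , i-1∉ , i≢1 with ∈-filter⁻ Q? {xs = 1… m} i∈X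
  ...   | i∈1… , q with ∈-1…⁻ m i∈1…
  ...     | s≤s {n = j} _ , j<m = j , refl , j<m , dec-true (Q? (suc j)) q , before j i-1∉ i≢1 j<m
    where
    before : ∀ j → j ∉ X → suc j ≢ 1 → j < m → preceded true d j ≡ false
    before zero    _  1≢1 _   = ⊥-elim (1≢1 refl)
    before (suc j) j∉ _   j<m = dec-false (Q? (suc j)) λ q →
      j∉ (∈-filter⁺ Q? (∈-1… (s≤s z≤n) (<⇒≤ j<m)) q)

  ∈-Peak⁺ : ∀ {j} → j < m → d j ≡ true → preceded true d j ≡ false → suc j ∈ Peak X
  ∈-Peak⁺ {suc j} j<m now before = ∈-filter⁺ _
    (∈-filter⁺ Q? (∈-1… (s≤s z≤n) j<m) (witness (Q? (suc (suc j))) now))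
    ((λ j∈ → refutation (Q? (suc j)) before (proj₂ (∈-filter⁻ Q? {xs = 1… m} j∈))) , λ ())

  private
    P : List ℕ
    P = Peak X

    P-linked : Linked _<_ P
    P-linked = Linkedₚ.filter⁺ _ <-trans (Linkedₚ.filter⁺ Q? <-trans (1…-linked m))

    sum-P : sum (comp (suc m) P) ≡ suc m
    sum-P = sum-comp (suc m) P P-linked (All.tabulate λ i∈ → m≤n⇒m≤1+n (i≤m i∈))
      where
      i≤m : ∀ {i} → i ∈ P → i ≤ m
      i≤m i∈ with ∈-Peak⁻ i∈
      ... | j , refl , j<m , _ = j<m

    Peak-P : Peak (set (comp (suc m) P)) ≡ P
    Peak-P = trans (cong Peak (set-comp (suc m) P P-linked)) (Peak-idem X)

    FIndex? : ∀ e → Decidable (λ β → FIndex β (flat e))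
    FIndex? e β = ⊨? (flat e) (sum β) ×-dec refines? (flat e) β

    F-hit : ∀ e β → FIndex β (flat e) → F β e ≡ ℤ.+ 1
    F-hit e β idx = trans
      (∑-count (refinements β) M e (_≟ᴸ flat e) (λ { (δ⊨ , _) → M-hit e (proj₁ δ⊨) })
                                               (λ { (δ⊨ , _) → M-miss e (proj₁ δ⊨) }))
      (cong ℤ.+_ (same-length {ys = flat e ∷ []}
        (Uniqueₚ.filter⁺ (_≟ᴸ flat e) (unique (refinements β))) ([] ∷ [])
        (λ δ∈ → here (proj₂ (∈-filter⁻ (_≟ᴸ flat e) {xs = elements (refinements β)} δ∈)))
        (λ { (here refl) → ∈-filter⁺ (_≟ᴸ flat e) (from (member (refinements β)) idx) refl })))

    F-miss : ∀ e β → ¬ FIndex β (flat e) → F β e ≡ ℤ.0ℤ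
    F-miss e β ¬idx = trans
      (∑-count (refinements β) M e (_≟ᴸ flat e) (λ { (δ⊨ , _) → M-hit e (proj₁ δ⊨) })
                                               (λ { (δ⊨ , _) → M-miss e (proj₁ δ⊨) }))
      (cong (ℤ.+_ ∘ length) (Listₚ.filter-none (_≟ᴸ flat e) (All.tabulate λ δ∈ →
        λ { refl → ¬idx (to (member (refinements β)) δ∈) })))

    terms : Monomial → List (List ℕ)
    terms e = filter (FIndex? e) (elements (K-indices (comp (suc m) P)))

    K-terms : ∀ e → K (comp (suc m) P) e
                  ≡ ℤ.+ (2 ^ (peaks (preceded true d) d m + 1) * length (terms e))
    K-terms e = trans (cong₂ (λ p s → ℤ.+ (2 ^ (p + 1)) ℤ.* s)
      (trans (cong length Peak-P) length-Peak)
      (∑-count (K-indices (comp (suc m) P)) F e (FIndex? e) (λ _ → F-hit e _) (λ _ → F-miss e _)))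
      (sym (ℤₚ.pos-* (2 ^ (peaks (preceded true d) d m + 1)) (length (terms e))))

  K-coefficient-zero : ∀ e → ¬ flat e ⊨ suc m → K (comp (suc m) P) e ≡ ℤ.0ℤ
  K-coefficient-zero e ¬⊨ = trans (K-terms e) (cong ℤ.+_ (trans
    (cong (λ ts → 2 ^ (peaks (preceded true d) d m + 1) * length ts)
      (Listₚ.filter-none (FIndex? e) (All.tabulate λ {β} β∈ (γ⊨ , _) →
        ¬⊨ (subst (flat e ⊨_)
          (trans (proj₂ (proj₁ (to (member (K-indices (comp (suc m) P))) β∈))) sum-P) γ⊨))))
    (*-zeroʳ (2 ^ (peaks (preceded true d) d m + 1)))))

  private
    choiceOK⁺ : ∀ d⁻ d e b⁻ b → (b ≡ true → e ≡ true) → (d ≡ true → d⁻ ≡ false → b ≢ b⁻) →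
                choiceOK d⁻ d e b⁻ b ≡ true
    choiceOK⁺ d⁻    d     false b⁻    true  be _ with be refl
    ... | ()
    choiceOK⁺ d⁻    false e     b⁻    false _ _ = refl
    choiceOK⁺ d⁻    false true  b⁻    true  _ _ = refl
    choiceOK⁺ true  true  e     b⁻    false _ _ = refl
    choiceOK⁺ true  true  true  b⁻    true  _ _ = refl
    choiceOK⁺ false true  e     true  false _ _ = refl
    choiceOK⁺ false true  e     false false _ pk = ⊥-elim (pk refl refl refl)
    choiceOK⁺ false true  true  true  true  _ pk = ⊥-elim (pk refl refl refl)
    choiceOK⁺ false true  true  false true  _ _ = refl

    choiceOK⁻ : ∀ d⁻ d e b⁻ b → choiceOK d⁻ d e b⁻ b ≡ true →
                (b ≡ true → e ≡ true) × (d ≡ true → d⁻ ≡ false → b ≢ b⁻)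
    choiceOK⁻ d⁻    d     true  b⁻    true  ok = (λ _ → refl) , λ { refl refl refl → contra ok }
      where
      contra : false ≢ true
      contra ()
    choiceOK⁻ d⁻    d     e     b⁻    false ok = (λ ()) , λ { refl refl refl → contra ok }
      where
      contra : false ≢ true
      contra ()

    -- Prepending false shifts the word by one place: bit `j` of `false ∷ bs` tells whether `j` is
    -- in set(β), that is, whether `suc j` is in set(β) + 1. Membership in the symmetric difference
    -- is then inequality of two bits.
    △-set⁺ : ∀ bs j → at bs j ≢ at (false ∷ bs) j →
             (set (decode bs) △ map suc (set (decode bs))) (suc j)
    △-set⁺ bs j b≢b⁻ with at bs j in eq | at (false ∷ bs) j in eq⁻
    ... | true  | true  = ⊥-elim (b≢b⁻ refl)
    ... | false | false = ⊥-elim (b≢b⁻ refl)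
    ... | true  | false = inj₁ (⇒∈-set bs j eq , λ j∈ → absurd j (∈-map⁻ suc j∈) eq⁻)
      where
      absurd : ∀ j → ∃[ i ] i ∈ set (decode bs) × suc j ≡ suc i → at (false ∷ bs) j ≢ false
      absurd j (i , i∈ , refl) eq′ with ∈-set⇒ bs i∈
      ... | k , refl , eq″ with trans (sym eq″) eq′
      ...   | ()
    △-set⁺ bs (suc j) b≢b⁻ | false | true =
      inj₂ ((λ j∈ → absurd (∈-set⇒ bs j∈)) , ∈-map⁺ suc (⇒∈-set bs j eq⁻))
      where
      absurd : ¬ (∃[ i ] suc (suc j) ≡ suc i × at bs i ≡ true)
      absurd (_ , refl , eq′) with trans (sym eq′) eq
      ... | ()

    △-set⁻ : ∀ bs j → (set (decode bs) △ map suc (set (decode bs))) (suc j) →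
             at bs j ≢ at (false ∷ bs) j
    △-set⁻ bs j (inj₁ (j∈ , j∉)) eq with ∈-set⇒ bs j∈
    △-set⁻ bs (suc j) (inj₁ (j∈ , j∉)) eq | _ , refl , now =
      j∉ (∈-map⁺ suc (⇒∈-set bs j (trans (sym eq) now)))
    △-set⁻ bs zero (inj₁ (j∈ , j∉)) eq | _ , refl , now with trans (sym now) eq
    ... | ()
    △-set⁻ bs j (inj₂ (j∉ , j∈)) eq with ∈-map⁻ suc j∈
    ... | i , i∈ , refl with ∈-set⇒ bs i∈
    ...   | k , refl , before = j∉ (⇒∈-set bs (suc k) (trans eq before))

  -- The contributing β are the decoded words of `choices`: refinement by γ is the clause
  -- `not b ∨ e` of `choiceOK`, and the condition at the peaks is its xor clause. The power of 2 is
  -- absorbed by `choices-markings`.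
  K-coefficient : ∀ e es → length es ≡ m → decode es ≡ flat e →
                  K (comp (suc m) P) e ≡ ℤ.+ length (markings d (at es) m)
  K-coefficient e es len γ = trans (K-terms e) (cong ℤ.+_ (trans
    (cong (2 ^ (peaks (preceded true d) d m + 1) *_) (trans
      (same-length (Uniqueₚ.filter⁺ (FIndex? e) (unique (K-indices (comp (suc m) P))))
        bits-unique sound complete)
      (Listₚ.length-map decode (choices d (at es) m))))
    (choices-markings d (at es) m)))
    where
    ok : ℕ → Bool → Bool → Bool
    ok j = choiceOK (preceded true d j) (d j) (at es j)

    bits-unique : Unique (map decode (choices d (at es) m))
    bits-unique = map-unique decode (choices d (at es) m) (paths-unique ok false m)
      λ {w} {v} w∈ v∈ → decode-injective w v (trans (length-choice w∈) (sym (length-choice v∈)))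
      where
      length-choice : ∀ {w} → w ∈ choices d (at es) m → length w ≡ m
      length-choice w∈ = proj₁ (to (∈-paths ok false m) w∈)

    sound : ∀ {β} → β ∈ terms e → β ∈ map decode (choices d (at es) m)
    sound {β} β∈ with ∈-filter⁻ (FIndex? e) {xs = elements (K-indices (comp (suc m) P))} β∈
    ... | β∈K , _ , refines with to (member (K-indices (comp (suc m) P))) β∈K
    ...   | β⊨ , peaks△ with encode m (subst (β ⊨_) sum-P β⊨)
    ...     | bs , len′ , refl = ∈-map⁺ decode (from (∈-paths ok false m {bs}) (len′ , λ j j<m →
      choiceOK⁺ (preceded true d j) (d j) (at es j) (at (false ∷ bs) j) (at bs j)
        (refines⇒below es bs (trans len (sym len′)) (subst (_Refines decode bs) (sym γ) refines) j)
        (λ now before → △-set⁻ bs j (All.lookup peaks△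
          (subst (suc j ∈_) (sym Peak-P) (∈-Peak⁺ j<m now before))))))

    complete : ∀ {β} → β ∈ map decode (choices d (at es) m) → β ∈ terms e
    complete β∈ with ∈-map⁻ decode β∈
    ... | bs , bs∈ , refl with to (∈-paths ok false m) bs∈
    ...   | len′ , oks = ∈-filter⁺ (FIndex? e)
      (from (member (K-indices (comp (suc m) P))) (β⊨ , All.tabulate λ {i} i∈ →
        peak△ (subst (i ∈_) Peak-P i∈)))
      (subst₂ _⊨_ γ (sym (trans (proj₂ β⊨) sum-P)) (subst (λ k → decode es ⊨ suc k) len (decode-⊨ es))
      , subst (_Refines decode bs) γ (below⇒refines es bs (trans len (sym len′)) below))
      where
      β⊨ : decode bs ⊨ sum (comp (suc m) P)
      β⊨ = subst (decode bs ⊨_) (trans (cong suc len′) (sym sum-P)) (decode-⊨ bs)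
      local : ∀ j → j < m → _
      local j j<m = choiceOK⁻ (preceded true d j) (d j) (at es j) (at (false ∷ bs) j) (at bs j) (oks j j<m)
      at⇒< : ∀ bs j → at bs j ≡ true → j < length bs
      at⇒< (b ∷ bs) zero    _  = s≤s z≤n
      at⇒< (b ∷ bs) (suc j) eq = s≤s (at⇒< bs j eq)
      below : ∀ j → at bs j ≡ true → at es j ≡ true
      below j eq = proj₁ (local j (subst (j <_) len′ (at⇒< bs j eq))) eq
      peak△ : ∀ {i} → i ∈ P → (set (decode bs) △ map suc (set (decode bs))) i
      peak△ i∈ with ∈-Peak⁻ i∈
      ... | j , refl , j<m , now , before = △-set⁺ bs j (proj₂ (local j j<m) now before)

-- Boxes and peak diagrams

boxes-unique : ∀ α → Unique (boxes α)
boxes-unique []      = []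
boxes-unique (a ∷ α) = Uniqueₚ.++⁺ (Uniqueₚ.map⁺ (λ { refl → refl }) (Uniqueₚ.allFin⁺ a))
  (Uniqueₚ.map⁺ (λ { refl → refl }) (boxes-unique α)) λ (h∈ , t∈) → disjoint h∈ t∈
  where
  disjoint : {b : Box (a ∷ α)} → b ∈ map here (allFin a) → b ∉ map there (boxes α)
  disjoint h∈ t∈ with ∈-map⁻ here h∈ | ∈-map⁻ there t∈
  ... | _ , _ , refl | _ , _ , ()

position-injective : ∀ {α} (b b′ : Box α) → col b ≡ col b′ → row b ≡ row b′ → b ≡ b′
position-injective (here c)  (here c′)  eqc _   = cong here (Finₚ.toℕ-injective (suc-injective eqc))
position-injective (there b) (there b′) eqc eqr = cong there (position-injective b b′ eqc (suc-injective eqr))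
position-injective (here c)  (there b)  _   eqr = ⊥-elim (<⇒≢ (row-positive b) (suc-injective eqr))
position-injective (there b) (here c)   _   eqr = ⊥-elim (<⇒≢ (row-positive b) (suc-injective (sym eqr)))

row≤length : ∀ {α} (b : Box α) → row b ≤ length α
row≤length (here _)  = s≤s z≤n
row≤length (there b) = s≤s (row≤length b)

PeakShape-tail : ∀ {a α} → PeakShape (a ∷ α) → PeakShape α
PeakShape-tail shape i i< = shape (suc i) (s≤s i<)

-- A row below another one is not the last part of a peak composition, so it has at least two boxes.
second-box : ∀ {α} → PeakShape α → (b : Box α) → ∀ r → 1 ≤ r → r < row b →
             ∃[ b₂ ] position {α} b₂ ≡ (2 , r)
second-box {suc (suc a) ∷ α} shape (there b) 1 _ _ = here (suc zero) , refl
second-box {zero ∷ α}     shape (there b) 1 _ _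
  with shape zero (s≤s (≤-trans (row-positive b) (row≤length b)))
... | ()
second-box {suc zero ∷ α} shape (there b) 1 _ _
  with shape zero (s≤s (≤-trans (row-positive b) (row≤length b)))
... | s≤s ()
second-box {a ∷ α}        shape (there b) (suc (suc r)) _ (s≤s r<)
  with second-box (PeakShape-tail shape) b (suc r) (s≤s z≤n) r<
... | b₂ , eq = there b₂ , cong₂ _,_ (cong proj₁ eq) (cong (suc ∘ proj₂) eq)
second-box shape (here c) (suc r) _ (s≤s ())

left-box : ∀ {α} (b : Box α) → ∃[ b₁ ] position {α} b₁ ≡ (1 , row b)
left-box {suc a ∷ α} (here c)  = here zero , refl
left-box {a ∷ α}     (there b) with left-box b
... | b₁ , eq = there b₁ , cong₂ _,_ (cong proj₁ eq) (cong (suc ∘ proj₂) eq)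

first-box : ∀ {α} → PeakShape α → (b : Box α) → ∀ r → 1 ≤ r → r ≤ row b →
            ∃[ b₁ ] position {α} b₁ ≡ (1 , r)
first-box shape b r 1≤r r≤ with m≤n⇒m<n∨m≡n r≤
... | inj₂ refl = left-box b
... | inj₁ r<   with second-box shape b r 1≤r r<
...   | b₂ , eq₂ with left-box b₂
...     | b₁ , eq₁ = b₁ , trans eq₁ (cong (1 ,_) (cong proj₂ eq₂))

-- Describes a peak diagram inside a peak shape without naming its composition. `downward` expresses
-- at once that no row is skipped and that every row below an occupied one has at least two boxes.
record Closed {α} (P : Box α → Set) : Set where
  field
    leftward : ∀ b b′ → row b ≡ row b′ → col b < col b′ → P b′ → P b
    downward : ∀ b₂ b → col b₂ ≡ 2 → row b₂ < row b → P b → P b₂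

FormPeakDiagram⇒downward : ∀ {α} {P : Box α → Set} → FormPeakDiagram P →
                           ∀ b₂ b → col b₂ ≡ 2 → row b₂ < row b → P b → P b₂
FormPeakDiagram⇒downward (β , (_ , shape) , ⊆D , D⊆) b₂ b col₂ r< Pb
  with ⊆D (b , refl , Pb)
... | d , eq with second-box shape d (row b₂) (row-positive b₂) (subst (row b₂ <_) (sym (cong proj₂ eq)) r<)
...   | d₂ , eq₂ with D⊆ (d₂ , eq₂)
...     | b′ , eq′ , Pb′ with position-injective b′ b₂ (trans (cong proj₁ eq′) (sym col₂)) (cong proj₂ eq′)
...       | refl = Pb′

initial-segment : ∀ a {P : Fin a → Set} → Decidable P → (∀ i j → toℕ i < toℕ j → P j → P i) →
                  ∃[ c ] c ≤ a × (∀ i → P i → toℕ i < c) × (∀ i → toℕ i < c → P i)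
initial-segment zero    P? down = 0 , z≤n , (λ ()) , λ ()
initial-segment (suc a) P? down with P? zero
... | no ¬p = 0 , z≤n
            , (λ { zero p → ⊥-elim (¬p p) ; (suc i) p → ⊥-elim (¬p (down zero (suc i) (s≤s z≤n) p)) })
            , λ _ ()
... | yes p with initial-segment a (P? ∘ suc) (λ i j i<j → down (suc i) (suc j) (s≤s i<j))
...   | c , c≤a , below , above′ = suc c , s≤s c≤a
  , (λ { zero _ → s≤s z≤n ; (suc i) q → s≤s (below i q) })
  , λ { zero _ → p ; (suc i) (s≤s i<c) → above′ i i<c }

-- The composition is assembled row by row from the bottom, each row cut to its initial segment in
-- `P`. Closure downward makes a row longer than 1 as soon as something above it is in `P`, which is
-- the peak shape.
Closed⇒FormPeakDiagram : ∀ {α} {P : Box α → Set} → PeakShape α → Decidable P → Closed P → FormPeakDiagram P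
Closed⇒FormPeakDiagram {α} {P} shape P? closed with diagram α shape P? closed
  where
  Diagram : ∀ α → (Box α → Set) → Set
  Diagram α P = ∃[ β ] All (0 <_) β × PeakShape β × (∀ b → P b → D β (position b))
              × (∀ (d : Box β) → ∃[ b ] position {α} b ≡ position d × P b)

  diagram : ∀ α {P : Box α → Set} → PeakShape α → Decidable P → Closed P → Diagram α P
  diagram []      shape P? closed = [] , [] , (λ ()) , (λ ()) , λ ()
  diagram (a ∷ α) {P} shape P? closed
    with initial-segment a (P? ∘ here) (λ i j i<j → Closed.leftward closed (here i) (here j) refl (s≤s i<j))
       | diagram α (PeakShape-tail shape) (P? ∘ there) (record
          { leftward = λ b b′ eqr c< → Closed.leftward closed (there b) (there b′) (cong suc eqr) c<
          ; downward = λ b₂ b col₂ r< → Closed.downward closed (there b₂) (there b) col₂ (s≤s r<) })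
  ... | c , c≤a , below , above′ | β , pos , shapeβ , ⊆D , D⊆ = build c c≤a below above′ β pos shapeβ ⊆D D⊆
    where
    long : ∀ {c} → (∀ i → P (here i) → toℕ i < c) → (b : Box α) → P (there b) → 1 < c
    long below b Pb with second-box shape (there b) 1 ≤-refl (s≤s (row-positive b))
    ... | here i , eq
      with below i (Closed.downward closed (here i) (there b) (cong proj₁ eq) (s≤s (row-positive b)) Pb)
    ...   | i<c = subst (_< _) (suc-injective (cong proj₁ eq)) i<c
    long below b Pb | there b₂ , eq = ⊥-elim (<⇒≢ (row-positive b₂) (sym (suc-injective (cong proj₂ eq))))

    build : ∀ c → c ≤ a → (∀ i → P (here i) → toℕ i < c) → (∀ i → toℕ i < c → P (here i)) →
            ∀ β → All (0 <_) β → PeakShape β → (∀ b → P (there b) → D β (position b)) →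
            (∀ (d : Box β) → ∃[ b ] position {α} b ≡ position d × P (there b)) → Diagram (a ∷ α) P
    -- A bottom row without boxes of `P` rules out boxes above it, so the composition ends here
    -- instead of acquiring a part 0.
    build zero c≤a below above′ β pos shapeβ ⊆D D⊆ = [] , [] , (λ ()) , (λ b Pb → ⊥-elim (none b Pb)) , λ ()
      where
      none : ∀ b → ¬ P b
      none (here i)  Pb with below i Pb
      ... | ()
      none (there b) Pb with long below b Pb
      ... | ()
    build (suc c) c≤a below above′ β pos shapeβ ⊆D D⊆ = suc c ∷ β , s≤s z≤n ∷ pos , shape′ pos D⊆ , ⊆D′ , D⊆′
      where
      shape′ : All (0 <_) β → (∀ (d : Box β) → ∃[ b ] position {α} b ≡ position d × P (there b)) →
               PeakShape (suc c ∷ β)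
      shape′ (s≤s z≤n ∷ _) D⊆ zero _ with D⊆ (here zero)
      ... | b , _ , Pb = long below b Pb
      shape′ [] _ zero (s≤s ())
      shape′ _ _ (suc i) (s≤s i<) = shapeβ i i<
      ⊆D′ : ∀ b → P b → D (suc c ∷ β) (position b)
      ⊆D′ (here i)  Pb = here (fromℕ< (below i Pb)) , cong (λ k → suc k , 1) (Finₚ.toℕ-fromℕ< (below i Pb))
      ⊆D′ (there b) Pb with ⊆D b Pb
      ... | d , eq = there d , cong₂ _,_ (cong proj₁ eq) (cong (suc ∘ proj₂) eq)
      D⊆′ : ∀ (d : Box (suc c ∷ β)) → ∃[ b ] position {a ∷ α} b ≡ position d × P b
      D⊆′ (here i) = here (fromℕ< i<a) , cong (λ k → suc k , 1) (Finₚ.toℕ-fromℕ< i<a)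
                   , above′ (fromℕ< i<a) (subst (_< suc c) (sym (Finₚ.toℕ-fromℕ< i<a)) (Finₚ.toℕ<n i))
        where
        i<a = ≤-trans (Finₚ.toℕ<n i) c≤a
      D⊆′ (there d) with D⊆ d
      ... | b , eq , Pb = there b , cong₂ _,_ (cong proj₁ eq) (cong (suc ∘ proj₂) eq) , Pb
... | β , pos , shapeβ , ⊆D , D⊆ = β , ((pos , refl) , shapeβ)
  , (λ { (b , refl , Pb) → ⊆D b Pb }) , (λ { (d , refl) → D⊆ d })

-- Fillings and numbers of boxes

fill : ∀ {A : Set} {α} → (Box α → A) → Filling A α
fill {α = []}    f = []
fill {α = a ∷ α} f = Vec.tabulate (f ∘ here) ∷ fill (f ∘ there)

fill-‼ : ∀ {A : Set} {α} (f : Box α → A) b → fill f ‼ b ≡ f b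
fill-‼ f (here c)  = Vecₚ.lookup∘tabulate (f ∘ here) c
fill-‼ f (there b) = fill-‼ (f ∘ there) b

filling-ext : ∀ {A : Set} {α} (T U : Filling A α) → (∀ b → T ‼ b ≡ U ‼ b) → T ≡ U
filling-ext []      []      _  = refl
filling-ext (v ∷ T) (w ∷ U) eq = cong₂ _∷_
  (trans (sym (Vecₚ.tabulate∘lookup v)) (trans (Vecₚ.tabulate-cong (eq ∘ here)) (Vecₚ.tabulate∘lookup w)))
  (filling-ext T U (eq ∘ there))

# : ∀ {α} {P : Box α → Set} → Decidable P → ℕ
# {α} P? = length (filter P? (boxes α))

module _ {A : Set} {P Q : A → Set} (P? : Decidable P) (Q? : Decidable Q) where

  length-filter-mono : (∀ {x} → P x → Q x) → ∀ xs → length (filter P? xs) ≤ length (filter Q? xs)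
  length-filter-mono P⊆Q []       = z≤n
  length-filter-mono P⊆Q (x ∷ xs) with P? x | Q? x
  ... | yes p | yes q = s≤s (length-filter-mono P⊆Q xs)
  ... | yes p | no ¬q = ⊥-elim (¬q (P⊆Q p))
  ... | no ¬p | yes q = m≤n⇒m≤1+n (length-filter-mono P⊆Q xs)
  ... | no ¬p | no ¬q = length-filter-mono P⊆Q xs

  length-filter-strict : (∀ {x} → P x → Q x) → ∀ {x} xs → x ∈ xs → ¬ P x → Q x →
                         length (filter P? xs) < length (filter Q? xs)
  length-filter-strict P⊆Q (x ∷ xs) (here refl) ¬p q with P? x | Q? x
  ... | yes p | _     = ⊥-elim (¬p p)
  ... | no _  | yes _ = s≤s (length-filter-mono P⊆Q xs)
  ... | no _  | no ¬q = ⊥-elim (¬q q)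
  length-filter-strict P⊆Q (x ∷ xs) (there y∈) ¬p q with P? x | Q? x
  ... | yes p | yes _ = s≤s (length-filter-strict P⊆Q xs y∈ ¬p q)
  ... | yes p | no ¬q = ⊥-elim (¬q (P⊆Q p))
  ... | no _  | yes _ = m≤n⇒m≤1+n (length-filter-strict P⊆Q xs y∈ ¬p q)
  ... | no _  | no _  = length-filter-strict P⊆Q xs y∈ ¬p q

  length-filter-⊎ : {R : A → Set} (R? : Decidable R) → (∀ {x} → R x → P x ⊎ Q x) → (∀ {x} → P x → R x) →
                    (∀ {x} → Q x → R x) → (∀ {x} → P x → Q x → ⊥) → ∀ xs →
                    length (filter R? xs) ≡ length (filter P? xs) + length (filter Q? xs)
  length-filter-⊎ R? split P⊆ Q⊆ disj []       = refl
  length-filter-⊎ R? split P⊆ Q⊆ disj (x ∷ xs)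
    with length-filter-⊎ R? split P⊆ Q⊆ disj xs | R? x | P? x | Q? x
  ... | ih | _     | yes p | yes q = ⊥-elim (disj p q)
  ... | ih | yes _ | yes _ | no _  = cong suc ih
  ... | ih | yes _ | no _  | yes _ = trans (cong suc ih) (sym (+-suc _ _))
  ... | ih | yes r | no ¬p | no ¬q with split r
  ...   | inj₁ p = ⊥-elim (¬p p)
  ...   | inj₂ q = ⊥-elim (¬q q)
  length-filter-⊎ R? split P⊆ Q⊆ disj (x ∷ xs) | ih | no ¬r | yes p | _     = ⊥-elim (¬r (P⊆ p))
  length-filter-⊎ R? split P⊆ Q⊆ disj (x ∷ xs) | ih | no ¬r | no _  | yes q = ⊥-elim (¬r (Q⊆ q))
  length-filter-⊎ R? split P⊆ Q⊆ disj (x ∷ xs) | ih | no ¬r | no _  | no _  = ih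

module _ {α : List ℕ} {P Q : Box α → Set} (P? : Decidable P) (Q? : Decidable Q) where

  #-mono : (∀ {b} → P b → Q b) → # P? ≤ # Q?
  #-mono P⊆Q = length-filter-mono P? Q? P⊆Q (boxes α)

  #-strict : (∀ {b} → P b → Q b) → ∀ b → ¬ P b → Q b → # P? < # Q?
  #-strict P⊆Q b = length-filter-strict P? Q? P⊆Q (boxes α) (∈-boxes b)

#-cong : ∀ {α} {P Q : Box α → Set} (P? : Decidable P) (Q? : Decidable Q) →
         (∀ {b} → P b → Q b) → (∀ {b} → Q b → P b) → # P? ≡ # Q?
#-cong P? Q? f g = ≤-antisym (#-mono P? Q? f) (#-mono Q? P? g)

#-none : ∀ {α} {P : Box α → Set} (P? : Decidable P) → (∀ b → ¬ P b) → # P? ≡ 0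
#-none {α} P? none = cong length (Listₚ.filter-none P? {boxes α} (All.tabulate λ {b} _ → none b))

#-all : ∀ {α} {P : Box α → Set} (P? : Decidable P) → (∀ b → P b) → # P? ≡ sum α
#-all {α} P? all = trans
  (cong length (Listₚ.filter-all P? {boxes α} (All.tabulate λ {b} _ → all b))) (length-boxes α)

#≤sum : ∀ {α} {P : Box α → Set} (P? : Decidable P) → # P? ≤ sum α
#≤sum {α} P? = ≤-trans (Listₚ.length-filter P? (boxes α)) (≤-reflexive (length-boxes α))

#-positive : ∀ {α} {P : Box α → Set} (P? : Decidable P) b → P b → 0 < # P?
#-positive P? b p = ∈-length (∈-filter⁺ P? (∈-boxes b) p)

#-unique : ∀ {α} {P : Box α → Set} (P? : Decidable P) → (∀ b b′ → P b → P b′ → b ≡ b′) → # P? ≤ 1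
#-unique {α} P? same with filter P? (boxes α) in eq | Uniqueₚ.filter⁺ P? (boxes-unique α)
... | []         | _             = z≤n
... | b ∷ []     | _             = ≤-refl
... | b ∷ b′ ∷ _ | (b≢b′ ∷ _) ∷ _ = ⊥-elim (b≢b′ (same b b′ (holds (here refl)) (holds (there (here refl)))))
  where
  holds : ∀ {b} → b ∈ _ → _
  holds b∈ = proj₂ (∈-filter⁻ P? {xs = boxes α} (subst (_ ∈_) (sym eq) b∈))

#≡1⇒∃ : ∀ {α} {P : Box α → Set} (P? : Decidable P) → # P? ≡ 1 → ∃ P
#≡1⇒∃ {α} P? eq₁ with filter P? (boxes α) in eq
... | b ∷ _ = b , proj₂ (∈-filter⁻ P? {xs = boxes α} (subst (b ∈_) (sym eq) (here refl)))

#≡1⇒unique : ∀ {α} {P : Box α → Set} (P? : Decidable P) → # P? ≡ 1 → ∀ {b b′} → P b → P b′ → b ≡ b′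
#≡1⇒unique {α} P? eq₁ {b} {b′} p p′
  with filter P? (boxes α) | ∈-filter⁺ P? (∈-boxes b) p | ∈-filter⁺ P? (∈-boxes b′) p′
... | _ ∷ [] | here refl | here refl = refl

-- Weights and standard fillings

cum : List ℕ → ℕ → ℕ
cum γ k = sum (take k γ)

entry : List ℕ → ℕ → ℕ
entry []      _       = 0
entry (g ∷ γ) zero    = g
entry (g ∷ γ) (suc k) = entry γ k

cum-suc : ∀ γ k → cum γ (suc k) ≡ cum γ k + entry γ k
cum-suc []      zero    = refl
cum-suc []      (suc k) = refl
cum-suc (g ∷ γ) zero    = +-identityʳ g
cum-suc (g ∷ γ) (suc k) = trans (cong (g +_) (cum-suc γ k)) (sym (+-assoc g (cum γ k) (entry γ k)))

cum-all : ∀ γ → cum γ (length γ) ≡ sum γ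
cum-all []      = refl
cum-all (g ∷ γ) = cong (g +_) (cum-all γ)

entry-beyond : ∀ γ k → length γ ≤ k → entry γ k ≡ 0
entry-beyond []      k       _        = refl
entry-beyond (g ∷ γ) (suc k) (s≤s l≤k) = entry-beyond γ k l≤k

entry-positive : ∀ γ k → All (0 <_) γ → k < length γ → 0 < entry γ k
entry-positive (g ∷ γ) zero    (0<g ∷ _) _         = 0<g
entry-positive (g ∷ γ) (suc k) (_ ∷ pos) (s≤s k<l) = entry-positive γ k pos k<l

entry-map-interval : ∀ (f : ℕ → ℕ) a n k → k < n → entry (map f (interval a n)) k ≡ f (suc (a + k))
entry-map-interval f a (suc n) zero    _         = cong (f ∘ suc) (sym (+-identityʳ a))
entry-map-interval f a (suc n) (suc k) (s≤s k<n) =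
  trans (entry-map-interval f (suc a) n k k<n) (cong (f ∘ suc) (sym (+-suc a k)))

length-interval : ∀ a n → length (interval a n) ≡ n
length-interval a zero    = refl
length-interval a (suc n) = cong suc (length-interval (suc a) n)

map-interval-entry : ∀ (f : ℕ → ℕ) a γ → (∀ k → f (suc (a + k)) ≡ entry γ k) →
                     map f (interval a (length γ)) ≡ γ
map-interval-entry f a []      eq = refl
map-interval-entry f a (g ∷ γ) eq = cong₂ _∷_
  (trans (cong (f ∘ suc) (sym (+-identityʳ a))) (eq 0))
  (map-interval-entry f (suc a) γ (λ k → trans (cong (f ∘ suc) (sym (+-suc a k))) (eq (suc k))))

-- The index of the part of decode es that contains position j (positions are counted from 0).
blk : List Bool → ℕ → ℕ
blk es           zero    = 1
blk []           (suc j) = 1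
blk (true  ∷ es) (suc j) = suc (blk es j)
blk (false ∷ es) (suc j) = blk es j

blk-positive : ∀ es j → 1 ≤ blk es j
blk-positive es           zero    = ≤-refl
blk-positive []           (suc j) = ≤-refl
blk-positive (true  ∷ es) (suc j) = s≤s z≤n
blk-positive (false ∷ es) (suc j) = blk-positive es j

blk-suc-true : ∀ es j → at es j ≡ true → blk es (suc j) ≡ suc (blk es j)
blk-suc-true (true  ∷ es) zero    _  = refl
blk-suc-true (true  ∷ es) (suc j) eq = cong suc (blk-suc-true es j eq)
blk-suc-true (false ∷ es) (suc j) eq = blk-suc-true es j eq

blk-suc-false : ∀ es j → at es j ≡ false → blk es (suc j) ≡ blk es j
blk-suc-false []           zero    _  = refl
blk-suc-false []           (suc j) _  = refl
blk-suc-false (false ∷ es) zero    _  = refl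
blk-suc-false (true  ∷ es) (suc j) eq = cong suc (blk-suc-false es j eq)
blk-suc-false (false ∷ es) (suc j) eq = blk-suc-false es j eq

cum-increment : ∀ es k → cum (increment (decode es)) (suc k) ≡ suc (cum (decode es) (suc k))
cum-increment es k with decode es | decode-cons es
... | _ | _ , _ , refl = refl

-- With its converse, this links the two descriptions of γ in use: bit words for the rules between
-- neighbours, partial sums for the weights.
blk≤⇒<cum : ∀ es j k → j ≤ length es → blk es j ≤ k → j < cum (decode es) k
blk≤⇒<cum es           zero    (suc k) _ _         with decode es | decode-cons es
... | _ | _ , _ , refl = s≤s z≤n
blk≤⇒<cum (true  ∷ es) (suc j) (suc k) (s≤s j≤) (s≤s b≤k) = s≤s (blk≤⇒<cum es j k j≤ b≤k)
blk≤⇒<cum (false ∷ es) (suc j) (suc k) (s≤s j≤) b≤k       =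
  subst (suc j <_) (sym (cum-increment es k)) (s≤s (blk≤⇒<cum es j (suc k) j≤ b≤k))
blk≤⇒<cum (false ∷ es) (suc j) zero    (s≤s j≤) b≤k       = ⊥-elim (<⇒≱ (blk-positive es j) b≤k)

<cum⇒blk≤ : ∀ es j k → j ≤ length es → j < cum (decode es) k → blk es j ≤ k
<cum⇒blk≤ es           zero    (suc k) _        _        = s≤s z≤n
<cum⇒blk≤ (true  ∷ es) (suc j) (suc k) (s≤s j≤) (s≤s j<) = s≤s (<cum⇒blk≤ es j k j≤ j<)
<cum⇒blk≤ (false ∷ es) (suc j) (suc k) (s≤s j≤) j<       =
  <cum⇒blk≤ es j (suc k) j≤ (≤-pred (subst (suc j <_) (cum-increment es k) j<))

module _ {α : List ℕ} (f : Box α → ℕ) where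

  #≤-suc : ∀ k → # (λ b → f b ≤? suc k) ≡ # (λ b → f b ≤? k) + # (λ b → f b ≟ suc k)
  #≤-suc k = length-filter-⊎ (λ b → f b ≤? k) (λ b → f b ≟ suc k) (λ b → f b ≤? suc k)
    split m≤n⇒m≤1+n ≤-reflexive (λ p q → <⇒≱ (≤-reflexive (sym q)) p) (boxes α)
    where
    split : ∀ {b} → f b ≤ suc k → f b ≤ k ⊎ f b ≡ suc k
    split p with m≤n⇒m<n∨m≡n p
    ... | inj₁ (s≤s q) = inj₁ q
    ... | inj₂ q       = inj₂ q

  -- n values in [1, n] without repetition: at most k of them are ≤ k and at most n ∸ k are > k.
  injective⇒once : (∀ b → 1 ≤ f b × f b ≤ sum α) → (∀ b b′ → f b ≡ f b′ → b ≡ b′) →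
                   ∀ k → k ≤ sum α → 1 ≤ k → # (λ b → f b ≟ k) ≡ 1
  injective⇒once bounds injective (suc k) k<n _ = sym (+-cancelˡ-≡ k 1 _
    (trans (+-comm k 1) (trans (sym (exact (suc k) k<n)) (trans (#≤-suc k)
      (cong (_+ # (λ b → f b ≟ suc k)) (exact k (<⇒≤ k<n)))))))
    where
    N : ℕ → ℕ
    N k = # (λ b → f b ≤? k)
    N₀ : N 0 ≡ 0
    N₀ = #-none (λ b → f b ≤? 0) λ b → <⇒≱ (proj₁ (bounds b))
    growth : ∀ k i → N (i + k) ≤ i + N k
    growth k zero    = ≤-refl
    growth k (suc i) = begin
      N (suc (i + k))                          ≡⟨ #≤-suc (i + k) ⟩
      N (i + k) + # (λ b → f b ≟ suc (i + k))  ≤⟨ +-mono-≤ (growth k i)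
        (#-unique (λ b → f b ≟ suc (i + k)) λ b b′ p q → injective b b′ (trans p (sym q))) ⟩
      i + N k + 1                              ≡⟨ +-comm (i + N k) 1 ⟩
      suc (i + N k)                            ∎
      where open ≤-Reasoning
    exact : ∀ k → k ≤ sum α → N k ≡ k
    exact k k≤n = ≤-antisym
      (subst₂ _≤_ (cong N (+-identityʳ k)) (trans (cong (k +_) N₀) (+-identityʳ k)) (growth 0 k))
      (+-cancelˡ-≤ (sum α ∸ k) k (N k) (begin
        sum α ∸ k + k    ≡⟨ m∸n+n≡m k≤n ⟩
        sum α            ≡⟨ sym (#-all (λ b → f b ≤? sum α) (proj₂ ∘ bounds)) ⟩
        N (sum α)        ≡⟨ cong N (sym (m∸n+n≡m k≤n)) ⟩
        N (sum α ∸ k + k) ≤⟨ growth k (sum α ∸ k) ⟩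
        sum α ∸ k + N k  ∎))
      where open ≤-Reasoning

module _ {α : List ℕ} {S : Filling ℕ α} (spct : IsSPCT S) where

  open IsSPCT spct

  spct-injective : ∀ b b′ → S ‼ b ≡ S ‼ b′ → b ≡ b′
  spct-injective b b′ eq = #≡1⇒unique (λ c → S ‼ c ≟ S ‼ b)
    (once (S ‼ b) (proj₂ (range b)) (proj₁ (range b))) refl (sym eq)

  spct-surjective : ∀ k → 1 ≤ k → k ≤ sum α → ∃[ b ] S ‼ b ≡ k
  spct-surjective k 1≤k k≤n = #≡1⇒∃ (λ c → S ‼ c ≟ k) (once k k≤n 1≤k)

  spct-#≤ : ∀ k → k ≤ sum α → # (λ b → S ‼ b ≤? k) ≡ k
  spct-#≤ zero    _   = #-none (λ b → S ‼ b ≤? 0) λ b → <⇒≱ (proj₁ (range b))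
  spct-#≤ (suc k) k<n = trans (#≤-suc (S ‼_) k)
    (trans (cong₂ _+_ (spct-#≤ k (<⇒≤ k<n)) (once (suc k) k<n (s≤s z≤n))) (+-comm k 1))

  -- In the initial diagram bounded by the entry of `b`, the box `b` forces the second box of every
  -- lower row; distinct entries make the inequality strict.
  spct-downward : ∀ b₂ b → col b₂ ≡ 2 → row b₂ < row b → S ‼ b₂ < S ‼ b
  spct-downward b₂ b col₂ r< = ≤∧≢⇒<
    (FormPeakDiagram⇒downward (initial (S ‼ b) (proj₂ (range b))) b₂ b col₂ r< ≤-refl)
    (λ eq → <⇒≢ r< (cong row (spct-injective b₂ b eq)))

module _ {α : List ℕ} (T : Filling Letter α) where

  private
    N : ℕ → ℕ
    N k = # (λ b → value (T ‼ b) ≤? k)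

  ∈⇒≤⊔ : ∀ {x} xs → x ∈ xs → x ≤ foldr _⊔_ 0 xs
  ∈⇒≤⊔ (x ∷ xs) (here refl) = m≤m⊔n x _
  ∈⇒≤⊔ (x ∷ xs) (there x∈)  = ≤-trans (∈⇒≤⊔ xs x∈) (m≤n⊔m x _)

  value≤max : ∀ b → value (T ‼ b) ≤ maxValue T
  value≤max b = ∈⇒≤⊔ (map (λ b → value (T ‼ b)) (boxes α)) (∈-map⁺ _ (∈-boxes b))

  max≤ : ∀ {l} → (∀ b → value (T ‼ b) ≤ l) → maxValue T ≤ l
  max≤ {l} bound = go (boxes α)
    where
    go : ∀ bs → foldr _⊔_ 0 (map (λ b → value (T ‼ b)) bs) ≤ l
    go []       = z≤n
    go (b ∷ bs) = ⊔-lub (bound b) (go bs)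

  #≤0 : (∀ b → 1 ≤ value (T ‼ b)) → N 0 ≡ 0
  #≤0 positive = #-none (λ b → value (T ‼ b) ≤? 0) λ b → <⇒≱ (positive b)

  length-weight : length (weight T) ≡ maxValue T
  length-weight = trans (Listₚ.length-map (wt T) (1… maxValue T))
    (trans (cong length (1…≡interval (maxValue T))) (length-interval 0 (maxValue T)))

  weight⇒cum : (∀ b → 1 ≤ value (T ‼ b)) → ∀ k → N k ≡ cum (weight T) k
  weight⇒cum positive zero    = #≤0 positive
  weight⇒cum positive (suc k) = trans (#≤-suc (λ b → value (T ‼ b)) k)
    (trans (cong₂ _+_ (weight⇒cum positive k) wt-entry) (sym (cum-suc (weight T) k)))
    where
    weight-interval : weight T ≡ map (wt T) (interval 0 (maxValue T))
    weight-interval = cong (map (wt T)) (1…≡interval (maxValue T))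
    wt-entry : wt T (suc k) ≡ entry (weight T) k
    wt-entry with suc k ≤? maxValue T
    ... | yes k<l = sym (trans (cong (λ γ → entry γ k) weight-interval)
      (entry-map-interval (wt T) 0 (maxValue T) k k<l))
    ... | no k≮l  = trans
      (#-none (λ b → value (T ‼ b) ≟ suc k) λ b eq → k≮l (subst (_≤ maxValue T) eq (value≤max b)))
      (sym (entry-beyond (weight T) k (subst (_≤ k) (sym length-weight) (≤-pred (≰⇒> k≮l)))))

  sum-weight : (∀ b → 1 ≤ value (T ‼ b)) → sum (weight T) ≡ sum α
  sum-weight positive = trans (sym (cum-all (weight T)))
    (trans (sym (weight⇒cum positive (length (weight T))))
    (#-all (λ b → value (T ‼ b) ≤? length (weight T)) λ b →
      subst (value (T ‼ b) ≤_) (sym length-weight) (value≤max b)))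

  module _ {γ : List ℕ} (positive : ∀ b → 1 ≤ value (T ‼ b)) (pos : All (0 <_) γ) (sumγ : sum γ ≡ sum α)
           (cumulative : ∀ k → N k ≡ cum γ k) where

    private
      wt-entry : ∀ k → wt T (suc k) ≡ entry γ k
      wt-entry k = +-cancelˡ-≡ (N k) _ _ (trans (sym (#≤-suc (λ b → value (T ‼ b)) k))
        (trans (cumulative (suc k)) (trans (cum-suc γ k) (cong (_+ entry γ k) (sym (cumulative k))))))

      N-all : N (length γ) ≡ sum α
      N-all = trans (cumulative (length γ)) (trans (cum-all γ) sumγ)

      value≤length : ∀ b → value (T ‼ b) ≤ length γ
      value≤length b with value (T ‼ b) ≤? length γ
      ... | yes p = p
      ... | no ¬p = ⊥-elim (<⇒≢ (subst (N (length γ) <_) (#-all (λ b → value (T ‼ b) ≤? maxValue T) value≤max)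
        (#-strict (λ b → value (T ‼ b) ≤? length γ) (λ b → value (T ‼ b) ≤? maxValue T)
          (λ _ → value≤max _) b ¬p (value≤max b))) N-all)

      max≡length : maxValue T ≡ length γ
      max≡length with m≤n⇒m<n∨m≡n (max≤ value≤length)
      ... | inj₂ eq  = eq
      ... | inj₁ max< = ⊥-elim (<⇒≢ (entry-positive γ (maxValue T) pos max<)
        (sym (trans (sym (wt-entry (maxValue T)))
        (#-none (λ b → value (T ‼ b) ≟ suc (maxValue T)) λ b eq → <⇒≱ (≤-reflexive (sym eq)) (value≤max b)))))

    -- `weight` is cut off at the largest value, which has to be `length γ`. It is not larger, since
    -- the values up to `length γ` already account for all boxes; it is not smaller, since a
    -- positive part of γ would then count boxes above the maximum.
    cum⇒weight : weight T ≡ γ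
    cum⇒weight = trans (cong (map (wt T)) (trans (1…≡interval (maxValue T)) (cong (interval 0) max≡length)))
                       (map-interval-entry (wt T) 0 γ wt-entry)

    cum⇒packed : ∀ i j → 1 ≤ i → i < j → wt T i ≡ 0 → wt T j ≡ 0
    cum⇒packed (suc i) (suc j) _ (s≤s i<j) wt≡0 =
      trans (wt-entry j) (entry-beyond γ j (≤-trans l≤i (<⇒≤ i<j)))
      where
      l≤i : length γ ≤ i
      l≤i = ≮⇒≥ λ i<l → <⇒≢ (entry-positive γ i pos i<l) (sym (trans (sym (wt-entry i)) wt≡0))

-- The reading order

value<⇒≺ : ∀ x y → value x < value y → x ≺ y
value<⇒≺ x y v< = begin-strict
  rank x              ≤⟨ upper x ⟩
  suc (2 * value x)   <⟨ ≤-reflexive (sym (*-suc 2 (value x))) ⟩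
  2 * suc (value x)   ≤⟨ *-monoʳ-≤ 2 v< ⟩
  2 * value y         ≤⟨ lower y ⟩
  rank y              ∎
  where
  open ≤-Reasoning
  upper : ∀ x → rank x ≤ suc (2 * value x)
  upper (marked i)   = n≤1+n (2 * i)
  upper (unmarked i) = ≤-refl
  lower : ∀ y → 2 * value y ≤ rank y
  lower (marked i)   = ≤-refl
  lower (unmarked i) = n≤1+n (2 * i)

≼⇒value≤ : ∀ x y → x ≼ y → value x ≤ value y
≼⇒value≤ x y x≼y = ≮⇒≥ λ v> → <⇒≱ (value<⇒≺ y x v>) x≼y

rank-injective : ∀ x y → rank x ≡ rank y → x ≡ y
rank-injective x y eq with ≤-antisym (≼⇒value≤ x y (≤-reflexive eq)) (≼⇒value≤ y x (≤-reflexive (sym eq)))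
rank-injective (marked i)   (marked .i)   eq | refl = refl
rank-injective (unmarked i) (unmarked .i) eq | refl = refl
rank-injective (marked i)   (unmarked .i) eq | refl = ⊥-elim (<⇒≢ (n<1+n (2 * i)) eq)
rank-injective (unmarked i) (marked .i)   eq | refl = ⊥-elim (<⇒≢ (n<1+n (2 * i)) (sym eq))

Key : Set
Key = ℕ × ℕ × ℕ

infix 4 _⊏_
_⊏_ : Key → Key → Set
_⊏_ = ×-Lex _≡_ _<_ (×-Lex _≡_ _<_ _<_)

⊏-isStrictTotalOrder : IsStrictTotalOrder (Pointwise _≡_ (Pointwise _≡_ _≡_)) _⊏_
⊏-isStrictTotalOrder = ×-isStrictTotalOrder <-isStrictTotalOrder
  (×-isStrictTotalOrder <-isStrictTotalOrder <-isStrictTotalOrder)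

-- Equal marked entries are read from the bottom row up, equal unmarked ones from the top row down
-- and left to right.
key : ∀ {α} → Letter → Box α → Key
key     x@(marked _)   b = rank x , row b , 0
key {α} x@(unmarked _) b = rank x , length α ∸ row b , col b

⊏⇒≼ : ∀ {α} x y (b b′ : Box α) → key x b ⊏ key y b′ → x ≼ y
⊏⇒≼ (marked _)   (marked _)   b b′ (inj₁ lt)        = <⇒≤ lt
⊏⇒≼ (marked _)   (marked _)   b b′ (inj₂ (eq , _)) = ≤-reflexive eq
⊏⇒≼ (marked _)   (unmarked _) b b′ (inj₁ lt)        = <⇒≤ lt
⊏⇒≼ (marked _)   (unmarked _) b b′ (inj₂ (eq , _)) = ≤-reflexive eq
⊏⇒≼ (unmarked _) (marked _)   b b′ (inj₁ lt)        = <⇒≤ lt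
⊏⇒≼ (unmarked _) (marked _)   b b′ (inj₂ (eq , _)) = ≤-reflexive eq
⊏⇒≼ (unmarked _) (unmarked _) b b′ (inj₁ lt)        = <⇒≤ lt
⊏⇒≼ (unmarked _) (unmarked _) b b′ (inj₂ (eq , _)) = ≤-reflexive eq

≺⇒⊏ : ∀ {α} x y (b b′ : Box α) → x ≺ y → key x b ⊏ key y b′
≺⇒⊏ (marked _)   (marked _)   b b′ lt = inj₁ lt
≺⇒⊏ (marked _)   (unmarked _) b b′ lt = inj₁ lt
≺⇒⊏ (unmarked _) (marked _)   b b′ lt = inj₁ lt
≺⇒⊏ (unmarked _) (unmarked _) b b′ lt = inj₁ lt

marked-⊏⇒row< : ∀ {α} i (b b′ : Box α) → key (marked i) b ⊏ key (marked i) b′ → row b < row b′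
marked-⊏⇒row< i b b′ (inj₁ lt)                     = ⊥-elim (<-irrefl refl lt)
marked-⊏⇒row< i b b′ (inj₂ (_ , inj₁ lt))          = lt
marked-⊏⇒row< i b b′ (inj₂ (_ , inj₂ (_ , ())))

unmarked-⊏⇒row≥ : ∀ {α} i (b b′ : Box α) → key (unmarked i) b ⊏ key (unmarked i) b′ →
                  row b′ < row b ⊎ (row b ≡ row b′ × col b < col b′)
unmarked-⊏⇒row≥ i b b′ (inj₁ lt)                       = ⊥-elim (<-irrefl refl lt)
unmarked-⊏⇒row≥ i b b′ (inj₂ (_ , inj₁ lt))            = inj₁ (≰⇒> λ r≤ → <⇒≱ lt (∸-monoʳ-≤ _ r≤))
unmarked-⊏⇒row≥ i b b′ (inj₂ (_ , inj₂ (eq , col<)))  =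
  -- Truncated subtraction can be cancelled because both rows are at most `length α`.
  inj₂ (∸-cancelˡ-≡ (row≤length b) (row≤length b′) eq , col<)

unmarked-row≥⇒⊏ : ∀ {α} i (b b′ : Box α) → row b′ < row b ⊎ (row b ≡ row b′ × col b < col b′) →
                  key (unmarked i) b ⊏ key (unmarked i) b′
unmarked-row≥⇒⊏ i b b′ (inj₁ row>)          = inj₂ (refl , inj₁ (∸-monoʳ-< row> (row≤length b)))
unmarked-row≥⇒⊏ i b b′ (inj₂ (eq , col<))   = inj₂ (refl , inj₂ (cong (_ ∸_) eq , col<))

module ⊏ = IsStrictTotalOrder ⊏-isStrictTotalOrder

descent? : ∀ {α} (S : Filling ℕ α) →
           Decidable (λ i → ∃[ b ] ∃[ b′ ] S ‼ b ≡ i × S ‼ b′ ≡ suc i × row b < row b′)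
descent? S i = any-box? λ b → any-box? λ b′ → (S ‼ b ≟ i) ×-dec (S ‼ b′ ≟ suc i) ×-dec (row b <? row b′)

-- Positions are counted from 0, so descents S j refers to the entries j + 1 and j + 2.
descents : ∀ {α} → Filling ℕ α → ℕ → Bool
descents S j = does (descent? S (suc j))

letter : Bool → ℕ → Letter
letter m v = if m then marked v else unmarked v

isMarked : Letter → Bool
isMarked (marked _)   = true
isMarked (unmarked _) = false

value-letter : ∀ m v → value (letter m v) ≡ v
value-letter true  v = refl
value-letter false v = refl

isMarked-letter : ∀ m v → isMarked (letter m v) ≡ m
isMarked-letter true  v = refl
isMarked-letter false v = refl

letter-η : ∀ x → letter (isMarked x) (value x) ≡ x
letter-η (marked _)   = refl
letter-η (unmarked _) = refl

relabel : ∀ {α} → List Bool → List Bool → Filling ℕ α → Filling Letter α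
relabel es w S = fill λ b → letter (at w (S ‼ b ∸ 1)) (blk es (S ‼ b ∸ 1))

keyAt : ∀ {α} → Filling Letter α → Box α → Key
keyAt T b = key (T ‼ b) b

outside? : ∀ {α} (T : Filling Letter α) b → Decidable (λ b′ → ¬ (keyAt T b ⊏ keyAt T b′))
outside? T b b′ = ¬? (keyAt T b ⊏.<? keyAt T b′)

-- The rank of a box in the reading order. The box itself is counted, so entries start at 1.
std : ∀ {α} → Filling Letter α → Filling ℕ α
std T = fill λ b → # (outside? T b)

std-‼ : ∀ {α} (T : Filling Letter α) b → std T ‼ b ≡ # (outside? T b)
std-‼ T = fill-‼ λ b → # (outside? T b)

-- `allowed` says that consecutive entries of a standard tableau are also consecutive in the reading
-- order. Equal marked letters are read upward, as across a descent; equal unmarked ones downward or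
-- rightward, as across a non-descent.
allowed⇒⊏ : ∀ {α} d e m m′ v v′ (b b′ : Box α) → allowed d e m m′ ≡ true →
            (e ≡ true → v′ ≡ suc v) → (e ≡ false → v′ ≡ v) → (d ≡ true → row b < row b′) →
            (d ≡ false → row b′ < row b ⊎ (row b ≡ row b′ × col b < col b′)) →
            key (letter m v) b ⊏ key (letter m′ v′) b′
allowed⇒⊏ d true m m′ v v′ b b′ _ step _ _ _ with step refl
... | refl = ≺⇒⊏ (letter m v) (letter m′ (suc v)) b b′ (value<⇒≺ (letter m v) (letter m′ (suc v))
  (subst₂ _<_ (sym (value-letter m v)) (sym (value-letter m′ (suc v))) ≤-refl))
allowed⇒⊏ d false m m′ v v′ b b′ ok _ same up down with same refl
allowed⇒⊏ true  false true  true  v v′ b b′ ok _ same up down | refl = inj₂ (refl , inj₁ (up refl))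
allowed⇒⊏ d     false true  false v v′ b b′ ok _ same up down | refl = inj₁ ≤-refl
allowed⇒⊏ false false false false v v′ b b′ ok _ same up down | refl = unmarked-row≥⇒⊏ v b b′ (down refl)

⊏⇒allowed : ∀ {α} d e x y (b b′ : Box α) → key x b ⊏ key y b′ → (e ≡ false → value x ≡ value y) →
            (row b < row b′ → d ≡ true) → (row b′ ≤ row b → d ≡ false) →
            allowed d e (isMarked x) (isMarked y) ≡ true
⊏⇒allowed d true  x y b b′ lt same up down = refl
⊏⇒allowed d false (marked i)   (unmarked j) b b′ lt same up down = refl
⊏⇒allowed d false (marked i)   (marked j)   b b′ lt same up down with same refl
... | refl = up (marked-⊏⇒row< i b b′ lt)
⊏⇒allowed d false (unmarked i) (marked j)   b b′ lt same up down with same refl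
... | refl = ⊥-elim (<⇒≱ (n<1+n (2 * i)) (⊏⇒≼ (unmarked i) (marked i) b b′ lt))
⊏⇒allowed d false (unmarked i) (unmarked j) b b′ lt same up down with same refl
... | refl = cong not (down (weaken (unmarked-⊏⇒row≥ i b b′ lt)))
  where
  weaken : row b′ < row b ⊎ (row b ≡ row b′ × col b < col b′) → row b′ ≤ row b
  weaken (inj₁ r<)       = <⇒≤ r<
  weaken (inj₂ (r≡ , _)) = ≤-reflexive (sym r≡)

Closed-value≤ : ∀ {α} (T : Filling Letter α) →
                (∀ b b′ → row b ≡ row b′ → col b < col b′ → T ‼ b ≼ T ‼ b′) →
                (∀ b₂ b → col b₂ ≡ 2 → row b₂ < row b → T ‼ b₂ ≼ T ‼ b) →
                ∀ k → Closed (λ b → value (T ‼ b) ≤ k)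
Closed-value≤ T rows down k = record
  { leftward = λ b b′ r≡ c< → ≤-trans (≼⇒value≤ (T ‼ b) (T ‼ b′) (rows b b′ r≡ c<))
  ; downward = λ b₂ b c₂ r< → ≤-trans (≼⇒value≤ (T ‼ b₂) (T ‼ b) (down b₂ b c₂ r<)) }

-- From marks on a standard tableau to a marked tableau

module Relabel {α : List ℕ} {m : ℕ} (shape : PeakShape α) (sumα : sum α ≡ suc m)
               {S : Filling ℕ α} (spct : IsSPCT S) {es : List Bool} (len : length es ≡ m)
               {w : List Bool} (path : IsPath (markOK (descents S) (at es)) true (suc m) w) where

  private
    module S = IsSPCT spct

    T : Filling Letter α
    T = relabel es w S

    pos : Box α → ℕ
    pos b = S ‼ b ∸ 1

    suc-pos : ∀ b → suc (pos b) ≡ S ‼ b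
    suc-pos b = m+[n∸m]≡n (proj₁ (S.range b))

    T-‼ : ∀ b → T ‼ b ≡ letter (at w (pos b)) (blk es (pos b))
    T-‼ = fill-‼ _

    value-T : ∀ b → value (T ‼ b) ≡ blk es (pos b)
    value-T b = trans (cong value (T-‼ b)) (value-letter (at w (pos b)) (blk es (pos b)))

  isMarked-relabel : ∀ b → isMarked (T ‼ b) ≡ at w (pos b)
  isMarked-relabel b = trans (cong isMarked (T-‼ b)) (isMarked-letter (at w (pos b)) (blk es (pos b)))

  private
    pos< : ∀ b → pos b < suc m
    pos< b = subst₂ _≤_ (sym (suc-pos b)) sumα (proj₂ (S.range b))

    adjacent : ∀ b b′ → S ‼ b′ ≡ suc (S ‼ b) → keyAt T b ⊏ keyAt T b′
    adjacent b b′ eq = subst₂ _⊏_ (cong (λ x → key x b) (sym (T-‼ b)))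
      (cong (λ x → key x b′) (sym (trans (T-‼ b′) (cong (λ j → letter (at w j) (blk es j)) next))))
      (allowed⇒⊏ (descents S j) (at es j) (at w j) (at w (suc j)) (blk es j) (blk es (suc j)) b b′
        (proj₂ path (suc j) (subst (_< suc m) next (pos< b′)))
        (blk-suc-true es j) (blk-suc-false es j) up down)
      where
      j = pos b
      next : pos b′ ≡ suc j
      next = suc-injective (trans (suc-pos b′) (trans eq (cong suc (sym (suc-pos b)))))
      up : descents S j ≡ true → row b < row b′
      up desc with witness (descent? S (suc j)) desc
      ... | c , c′ , Sc , Sc′ , r<
        with spct-injective spct c b (trans Sc (suc-pos b))
           | spct-injective spct c′ b′ (trans Sc′ (trans (cong suc (suc-pos b)) (sym eq)))
      ...   | refl | refl = r<
      down : descents S j ≡ false → row b′ < row b ⊎ (row b ≡ row b′ × col b < col b′)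
      down ¬desc with <-cmp (row b) (row b′)
      ... | tri< r< _ _ = ⊥-elim (refutation (descent? S (suc j)) ¬desc
                            (b , b′ , sym (suc-pos b) , trans eq (cong suc (sym (suc-pos b))) , r<))
      ... | tri> _ _ r> = inj₁ r>
      ... | tri≈ _ r≡ _ with <-cmp (col b) (col b′)
      ...   | tri< c< _ _ = inj₂ (r≡ , c<)
      ...   | tri≈ _ c≡ _ with position-injective b b′ c≡ r≡
      ...     | refl = ⊥-elim (<⇒≢ (n<1+n _) eq)
      down ¬desc | tri≈ _ r≡ _ | tri> _ _ c> =
        ⊥-elim (<-asym (S.rows-increase b′ b (sym r≡) c>) (subst (S ‼ b <_) (sym eq) ≤-refl))

    -- A path constrains only neighbouring entries; since every entry in between occurs in `S`,
    -- transitivity extends the comparison to all pairs.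
    distant : ∀ k b b′ → S ‼ b′ ≡ suc k + S ‼ b → keyAt T b ⊏ keyAt T b′
    distant zero    b b′ eq = adjacent b b′ eq
    distant (suc k) b b′ eq with spct-surjective spct (suc k + S ‼ b) (s≤s z≤n)
                                   (≤-trans (n≤1+n _) (subst (_≤ sum α) eq (proj₂ (S.range b′))))
    ... | c , Sc = ⊏.trans (distant k b c Sc) (adjacent c b′ (trans eq (cong suc (sym Sc))))

    <⇒⊏ : ∀ b b′ → S ‼ b < S ‼ b′ → keyAt T b ⊏ keyAt T b′
    <⇒⊏ b b′ lt = distant (S ‼ b′ ∸ suc (S ‼ b)) b b′
      (sym (trans (sym (+-suc _ (S ‼ b))) (m∸n+n≡m lt)))

    ⊏⇒< : ∀ b b′ → keyAt T b ⊏ keyAt T b′ → S ‼ b < S ‼ b′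
    ⊏⇒< b b′ lt with <-cmp (S ‼ b) (S ‼ b′)
    ... | tri< p _ _ = p
    ... | tri> _ _ p = ⊥-elim (⊏.asym lt (<⇒⊏ b′ b p))
    ... | tri≈ _ p _ with spct-injective spct b b′ p
    ...   | refl = ⊥-elim (⊏.irrefl (refl , refl , refl) lt)

    <⇒≼ : ∀ b b′ → S ‼ b < S ‼ b′ → T ‼ b ≼ T ‼ b′
    <⇒≼ b b′ lt = ⊏⇒≼ (T ‼ b) (T ‼ b′) b b′ (<⇒⊏ b b′ lt)

    marked-row< : ∀ b b′ {i} → T ‼ b ≡ marked i → T ‼ b′ ≡ marked i → S ‼ b < S ‼ b′ → row b < row b′
    marked-row< b b′ {i} eq eq′ lt = marked-⊏⇒row< i b b′
      (subst₂ _⊏_ (cong (λ x → key x b) eq) (cong (λ x → key x b′) eq′) (<⇒⊏ b b′ lt))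

    unmarked-row≥ : ∀ b b′ {i} → T ‼ b ≡ unmarked i → T ‼ b′ ≡ unmarked i → S ‼ b < S ‼ b′ →
                    row b′ < row b ⊎ (row b ≡ row b′ × col b < col b′)
    unmarked-row≥ b b′ {i} eq eq′ lt = unmarked-⊏⇒row≥ i b b′
      (subst₂ _⊏_ (cong (λ x → key x b) eq) (cong (λ x → key x b′) eq′) (<⇒⊏ b b′ lt))

    rows : ∀ b b′ → row b ≡ row b′ → col b < col b′ → T ‼ b ≼ T ‼ b′
    rows b b′ r≡ c< = <⇒≼ b b′ (S.rows-increase b b′ r≡ c<)

    first : ∀ b b′ → col b ≡ 1 → col b′ ≡ 1 → row b < row b′ → T ‼ b ≺ T ‼ b′
    first b b′ c₁ c₁′ r< = ≤∧≢⇒< (<⇒≼ b b′ S<) λ eq →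
      distinct (T ‼ b) refl (sym (rank-injective (T ‼ b) (T ‼ b′) eq))
      where
      S< = S.first-column b b′ c₁ c₁′ r<
      distinct : ∀ x → T ‼ b ≡ x → ¬ T ‼ b′ ≡ T ‼ b
      distinct (unmarked i) eq eq′ with unmarked-row≥ b b′ eq (trans eq′ eq) S<
      ... | inj₁ r>       = <-asym r< r>
      ... | inj₂ (r≡ , _) = <⇒≢ r< r≡
      -- The second box of the lower row lies between b and b′, so it would repeat the mark.
      distinct (marked i) eq eq′ with second-box shape b′ (row b) (row-positive b) r<
      ... | b₂ , p₂ = <⇒≢ (marked-row< b b₂ eq (trans (sym T₂) eq) S₂<) (sym r₂)
        where
        r₂ = cong proj₂ p₂
        S₂< = S.rows-increase b b₂ (sym r₂) (subst₂ _<_ (sym c₁) (sym (cong proj₁ p₂)) ≤-refl)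
        T₂ : T ‼ b ≡ T ‼ b₂
        T₂ = rank-injective (T ‼ b) (T ‼ b₂) (≤-antisym (<⇒≼ b b₂ S₂<) (subst (λ x → T ‼ b₂ ≼ x) eq′
          (<⇒≼ b₂ b′ (spct-downward spct b₂ b′ (cong proj₁ p₂) (subst (_< row b′) (sym r₂) r<)))))

    tableau : IsMarkedTableau T
    tableau = record
      { positive      = λ b → subst (1 ≤_) (sym (value-T b)) (blk-positive es (pos b))
      ; rows-increase = rows
      ; marked-once   = λ b b′ r≡ c< i eq eq′ →
          <⇒≢ (marked-row< b b′ eq eq′ (S.rows-increase b b′ r≡ c<)) r≡
      ; first-column  = first
      ; initial       = λ k _ → Closed⇒FormPeakDiagram shape (λ b → value (T ‼ b) ≤? k)
          (Closed-value≤ T rows (λ b₂ b c₂ r< → <⇒≼ b₂ b (spct-downward spct b₂ b c₂ r<)) k)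
      ; second-column = second
      }
      where
      -- The peak shape puts `b` before `b′` in the reading. A later equal unmarked entry cannot lie
      -- in a higher row, and `marked i` cannot follow `unmarked i`.
      second : ∀ b b′ → col b ≡ 2 → col b′ ≡ 1 → row b′ ≡ suc (row b) →
               ∀ i → T ‼ b ≡ unmarked i → T ‼ b′ ≢ unmarked i × T ‼ b′ ≢ marked i
      second b b′ c₂ _ r≡ i eq = same , lower
        where
        r<  = subst (row b <_) (sym r≡) (n<1+n (row b))
        S<  = spct-downward spct b b′ c₂ r<
        same : T ‼ b′ ≢ unmarked i
        same eq′ with unmarked-row≥ b b′ eq eq′ S<
        ... | inj₁ r>        = <-asym r< r>
        ... | inj₂ (r≡′ , _) = <⇒≢ r< r≡′
        lower : T ‼ b′ ≢ marked i
        lower eq′ = <⇒≱ (n<1+n (2 * i)) (subst₂ _≼_ eq eq′ (<⇒≼ b b′ S<))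

    -- The boxes of value at most `k` are those whose standard entry is at most the `k`-th partial
    -- sum of γ, and the entries of `S` are a permutation of 1, ..., n.
    cumulative : ∀ k → # (λ b → value (T ‼ b) ≤? k) ≡ cum (decode es) k
    cumulative k = trans (#-cong (λ b → value (T ‼ b) ≤? k) (λ b → S ‼ b ≤? cum (decode es) k)
        (λ {b} v≤ → subst (_≤ cum (decode es) k) (suc-pos b)
          (blk≤⇒<cum es (pos b) k (pos≤ b) (subst (_≤ k) (value-T b) v≤)))
        (λ {b} S≤ → subst (_≤ k) (sym (value-T b))
          (<cum⇒blk≤ es (pos b) k (pos≤ b) (subst (_≤ cum (decode es) k) (sym (suc-pos b)) S≤))))
      (spct-#≤ spct (cum (decode es) k) cum≤)
      where
      pos≤ : ∀ b → pos b ≤ length es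
      pos≤ b = subst (pos b ≤_) (sym len) (≤-pred (pos< b))
      cum≤ : cum (decode es) k ≤ sum α
      cum≤ = subst (cum (decode es) k ≤_)
        (trans (proj₂ (decode-⊨ es)) (trans (cong suc len) (sym sumα))) (take≤ k (decode es))
        where
        take≤ : ∀ k γ → cum γ k ≤ sum γ
        take≤ zero    γ       = z≤n
        take≤ (suc k) []      = z≤n
        take≤ (suc k) (g ∷ γ) = +-monoʳ-≤ g (take≤ k γ)

    sum-decode : sum (decode es) ≡ sum α
    sum-decode = trans (proj₂ (decode-⊨ es)) (trans (cong suc len) (sym sumα))

  relabel-MPCT : IsMPCT T
  relabel-MPCT = tableau
    , cum⇒packed T (IsMarkedTableau.positive tableau) (proj₁ (decode-⊨ es)) sum-decode cumulative

  weight-relabel : weight T ≡ decode es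
  weight-relabel = cum⇒weight T (IsMarkedTableau.positive tableau) (proj₁ (decode-⊨ es)) sum-decode cumulative

  -- The reading order of `T` is the order of the entries of `S`, so the rank of a box is its entry.
  std-relabel : std T ≡ S
  std-relabel = filling-ext (std T) S λ b → trans (std-‼ T b)
    (trans (#-cong (outside? T b) (λ b′ → S ‼ b′ ≤? S ‼ b)
              (λ ¬lt → ≮⇒≥ (λ lt → ¬lt (<⇒⊏ b _ lt)))
              (λ S≤ lt → <⇒≱ (⊏⇒< b _ lt) S≤))
           (spct-#≤ spct (S ‼ b) (proj₂ (S.range b))))

-- From a marked tableau to a standard tableau with marks

module Standardize {α : List ℕ} {m : ℕ} (shape : PeakShape α) (sumα : sum α ≡ suc m)
                   {T : Filling Letter α} (mpct : IsMPCT T) {es : List Bool} (len : length es ≡ m)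
                   (weight-T : weight T ≡ decode es) where

  private
    module T = IsMarkedTableau (proj₁ mpct)

    S : Filling ℕ α
    S = std T

    -- Keys of marked letters ignore the column; condition (1) separates such boxes, as a row never
    -- repeats a marked entry. The letters are variables so that they can be matched on.
    keys-injective : ∀ b b′ x y → T ‼ b ≡ x → T ‼ b′ ≡ y →
                     ¬ key x b ⊏ key y b′ → ¬ key y b′ ⊏ key x b → b ≡ b′
    keys-injective b b′ x y eq eq′ ≮ ≯ with rank-injective x y
      (≤-antisym (≮⇒≥ λ lt → ≯ (≺⇒⊏ y x b′ b lt)) (≮⇒≥ λ lt → ≮ (≺⇒⊏ x y b b′ lt)))
    keys-injective b b′ (marked i) _ eq eq′ ≮ ≯ | refl with <-cmp (row b) (row b′)
    ... | tri< r< _ _ = ⊥-elim (≮ (inj₂ (refl , inj₁ r<)))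
    ... | tri> _ _ r> = ⊥-elim (≯ (inj₂ (refl , inj₁ r>)))
    ... | tri≈ _ r≡ _ with <-cmp (col b) (col b′)
    ...   | tri< c< _ _ = ⊥-elim (T.marked-once b b′ r≡ c< i eq eq′)
    ...   | tri> _ _ c> = ⊥-elim (T.marked-once b′ b (sym r≡) c> i eq′ eq)
    ...   | tri≈ _ c≡ _ = position-injective b b′ c≡ r≡
    keys-injective b b′ (unmarked i) _ eq eq′ ≮ ≯ | refl with <-cmp (row b) (row b′)
    ... | tri< r< _ _ = ⊥-elim (≯ (unmarked-row≥⇒⊏ i b′ b (inj₁ r<)))
    ... | tri> _ _ r> = ⊥-elim (≮ (unmarked-row≥⇒⊏ i b b′ (inj₁ r>)))
    ... | tri≈ _ r≡ _ with <-cmp (col b) (col b′)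
    ...   | tri< c< _ _ = ⊥-elim (≮ (unmarked-row≥⇒⊏ i b b′ (inj₂ (r≡ , c<))))
    ...   | tri> _ _ c> = ⊥-elim (≯ (unmarked-row≥⇒⊏ i b′ b (inj₂ (sym r≡ , c>))))
    ...   | tri≈ _ c≡ _ = position-injective b b′ c≡ r≡

    ⊏⇒< : ∀ b b′ → keyAt T b ⊏ keyAt T b′ → S ‼ b < S ‼ b′
    ⊏⇒< b b′ lt = subst₂ _<_ (sym (std-‼ T b)) (sym (std-‼ T b′))
      (#-strict (outside? T b) (outside? T b′) (λ ¬lt lt′ → ¬lt (⊏.trans lt lt′)) b′
        (λ ¬lt → ¬lt lt) (⊏.irrefl (refl , refl , refl)))

    S-injective : ∀ b b′ → S ‼ b ≡ S ‼ b′ → b ≡ b′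
    S-injective b b′ eq = keys-injective b b′ (T ‼ b) (T ‼ b′) refl refl
      (λ lt → <⇒≢ (⊏⇒< b b′ lt) eq) (λ lt → <⇒≢ (⊏⇒< b′ b lt) (sym eq))

    <⇒⊏ : ∀ b b′ → S ‼ b < S ‼ b′ → keyAt T b ⊏ keyAt T b′
    <⇒⊏ b b′ lt with ⊏.compare (keyAt T b) (keyAt T b′)
    ... | tri< p _ _ = p
    ... | tri> _ _ p = ⊥-elim (<-asym lt (⊏⇒< b′ b p))
    ... | tri≈ ≮ _ ≯ with keys-injective b b′ (T ‼ b) (T ‼ b′) refl refl ≮ ≯
    ...   | refl = ⊥-elim (<-irrefl refl lt)

    bounds : ∀ b → 1 ≤ S ‼ b × S ‼ b ≤ sum α
    bounds b = subst (1 ≤_) (sym (std-‼ T b)) (#-positive (outside? T b) b (⊏.irrefl (refl , refl , refl)))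
             , subst (_≤ sum α) (sym (std-‼ T b)) (#≤sum (outside? T b))

    rows : ∀ b b′ → row b ≡ row b′ → col b < col b′ → S ‼ b < S ‼ b′
    rows b b′ r≡ c< = ⊏⇒< b b′ (row-⊏ (T ‼ b) (T ‼ b′) refl refl (T.rows-increase b b′ r≡ c<))
      where
      row-⊏ : ∀ x y → T ‼ b ≡ x → T ‼ b′ ≡ y → x ≼ y → key x b ⊏ key y b′
      row-⊏ x y eq eq′ x≼y with m≤n⇒m<n∨m≡n x≼y
      ... | inj₁ x≺y = ≺⇒⊏ x y b b′ x≺y
      ... | inj₂ x≡y with rank-injective x y x≡y
      row-⊏ (marked i)   _ eq eq′ x≼y | inj₂ x≡y | refl = ⊥-elim (T.marked-once b b′ r≡ c< i eq eq′)
      row-⊏ (unmarked i) _ eq eq′ x≼y | inj₂ x≡y | refl = unmarked-row≥⇒⊏ i b b′ (inj₂ (r≡ , c<))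

    -- Abstract because a with-abstraction over it would normalise the proof of value≤.
    abstract
      value-down : ∀ b₂ b → col b₂ ≡ 2 → row b₂ < row b → value (T ‼ b₂) ≤ value (T ‼ b)
      value-down b₂ b c₂ r< =
        FormPeakDiagram⇒downward (T.initial (value (T ‼ b)) (value≤ T mpct b)) b₂ b c₂ r< ≤-refl

    -- If the values agree, then so does the first entry of the row just above b₂, and condition (4)
    -- leaves only a marked entry for b₂.
    down : ∀ b₂ b → col b₂ ≡ 2 → row b₂ < row b → keyAt T b₂ ⊏ keyAt T b
    down b₂ b c₂ r< with m≤n⇒m<n∨m≡n (value-down b₂ b c₂ r<)
    ... | inj₁ v< = ≺⇒⊏ (T ‼ b₂) (T ‼ b) b₂ b (value<⇒≺ (T ‼ b₂) (T ‼ b) v<)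
    ... | inj₂ v≡ with first-box shape b (suc (row b₂)) (s≤s z≤n) r<
    ...   | b₁ , p₁ = by-mark (T ‼ b₂) (T ‼ b) refl refl
      where
      r₁ : row b₁ ≡ suc (row b₂)
      r₁ = cong proj₂ p₁
      column≼ : ∀ c c′ → col c ≡ 1 → col c′ ≡ 1 → row c ≤ row c′ → T ‼ c ≼ T ‼ c′
      column≼ c c′ col₁ col₁′ r≤ with m≤n⇒m<n∨m≡n r≤
      ... | inj₁ lt = <⇒≤ (T.first-column c c′ col₁ col₁′ lt)
      ... | inj₂ r≡ with position-injective c c′ (trans col₁ (sym col₁′)) r≡
      ...   | refl = ≤-refl
      row≼ : ∀ c c′ → row c ≡ row c′ → col c ≤ col c′ → T ‼ c ≼ T ‼ c′
      row≼ c c′ r≡ c≤ with m≤n⇒m<n∨m≡n c≤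
      ... | inj₁ lt = T.rows-increase c c′ r≡ lt
      ... | inj₂ c≡ with position-injective c c′ c≡ r≡
      ...   | refl = ≤-refl
      v₁ : value (T ‼ b₁) ≡ value (T ‼ b₂)
      v₁ with left-box b
      ... | b₀ , p₀ = ≤-antisym
        (subst (value (T ‼ b₁) ≤_) (sym v≡) (≼⇒value≤ (T ‼ b₁) (T ‼ b) (≤-trans
          (column≼ b₁ b₀ (cong proj₁ p₁) (cong proj₁ p₀) (subst₂ _≤_ (sym r₁) (sym (cong proj₂ p₀)) r<))
          (row≼ b₀ b (cong proj₂ p₀) (subst (_≤ col b) (sym (cong proj₁ p₀)) (col-positive b))))))
        (value-down b₂ b₁ c₂ (≤-reflexive (sym r₁)))
      by-mark : ∀ x y → T ‼ b₂ ≡ x → T ‼ b ≡ y → key x b₂ ⊏ key y b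
      by-mark (unmarked i) y eq eq′ = ⊥-elim (contra (T ‼ b₁) refl (trans v₁ (cong value eq)))
        where
        excluded = T.second-column b₂ b₁ c₂ (cong proj₁ p₁) r₁ i eq
        contra : ∀ z → T ‼ b₁ ≡ z → value (T ‼ b₁) ≢ i
        contra (marked j)   eq₁ v≡i =
          proj₂ excluded (trans eq₁ (cong marked (trans (cong value (sym eq₁)) v≡i)))
        contra (unmarked j) eq₁ v≡i =
          proj₁ excluded (trans eq₁ (cong unmarked (trans (cong value (sym eq₁)) v≡i)))
      by-mark (marked i) (marked j) eq eq′ with trans (cong value (sym eq)) (trans v≡ (cong value eq′))
      ... | refl = inj₂ (refl , inj₁ r<)
      by-mark (marked i) (unmarked j) eq eq′ with trans (cong value (sym eq)) (trans v≡ (cong value eq′))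
      ... | refl = inj₁ ≤-refl

  std-SPCT : IsSPCT S
  std-SPCT = record
    { range         = bounds
    ; once          = injective⇒once (S ‼_) bounds S-injective
    ; rows-increase = rows
    ; first-column  = λ b b′ c₁ c₁′ r< → ⊏⇒< b b′ (≺⇒⊏ (T ‼ b) (T ‼ b′) b b′ (T.first-column b b′ c₁ c₁′ r<))
    ; initial       = λ k _ → Closed⇒FormPeakDiagram shape (λ b → S ‼ b ≤? k) (record
        { leftward = λ b b′ r≡ c< → ≤-trans (<⇒≤ (rows b b′ r≡ c<))
        ; downward = λ b₂ b c₂ r< → ≤-trans (<⇒≤ (⊏⇒< b₂ b (down b₂ b c₂ r<))) })
    }

  private
    pos : Box α → ℕ
    pos b = S ‼ b ∸ 1

    suc-pos : ∀ b → suc (pos b) ≡ S ‼ b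
    suc-pos b = m+[n∸m]≡n (proj₁ (bounds b))

    pos< : ∀ b → pos b < suc m
    pos< b = subst₂ _≤_ (sym (suc-pos b)) sumα (proj₂ (bounds b))

    pos≤ : ∀ b → pos b ≤ length es
    pos≤ b = subst (pos b ≤_) (sym len) (≤-pred (pos< b))

    N : ℕ → ℕ
    N k = # (λ b → value (T ‼ b) ≤? k)

    N-cum : ∀ k → N k ≡ cum (decode es) k
    N-cum k = trans (weight⇒cum T T.positive k) (cong (λ γ → cum γ k) weight-T)

    outside⇒value≤ : ∀ b b′ → ¬ (keyAt T b ⊏ keyAt T b′) → value (T ‼ b′) ≤ value (T ‼ b)
    outside⇒value≤ b b′ ¬lt = ≮⇒≥ λ v< → ¬lt (≺⇒⊏ (T ‼ b) (T ‼ b′) b b′ (value<⇒≺ (T ‼ b) (T ‼ b′) v<))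

    value≤⇒S≤ : ∀ b k → value (T ‼ b) ≤ k → S ‼ b ≤ N k
    value≤⇒S≤ b k v≤ = subst (_≤ N k) (sym (std-‼ T b)) (#-mono (outside? T b) (λ b′ → value (T ‼ b′) ≤? k)
      (λ {b′} ¬lt → ≤-trans (outside⇒value≤ b b′ ¬lt) v≤))

    S≤⇒value≤ : ∀ b k → S ‼ b ≤ N k → value (T ‼ b) ≤ k
    S≤⇒value≤ b k S≤ = ≮⇒≥ λ v> → <⇒≱ (subst (N k <_) (sym (std-‼ T b))
      (#-strict (λ b′ → value (T ‼ b′) ≤? k) (outside? T b)
        (λ {b′} v≤ lt → <⇒≱ (≤-<-trans v≤ v>) (≼⇒value≤ (T ‼ b) (T ‼ b′) (⊏⇒≼ (T ‼ b) (T ‼ b′) b b′ lt)))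
        b (<⇒≱ v>) (⊏.irrefl (refl , refl , refl)))) S≤

    -- The reading order is compatible with values, so the boxes of value at most `k` receive
    -- exactly the ranks up to their number, which is the `k`-th partial sum of the weight.
    value≡blk : ∀ b → value (T ‼ b) ≡ blk es (pos b)
    value≡blk b = ≤-antisym
      (S≤⇒value≤ b (blk es (pos b)) (subst₂ _≤_ (suc-pos b) (sym (N-cum _))
        (blk≤⇒<cum es (pos b) _ (pos≤ b) ≤-refl)))
      (<cum⇒blk≤ es (pos b) (value (T ‼ b)) (pos≤ b)
        (subst₂ _≤_ (sym (suc-pos b)) (N-cum _) (value≤⇒S≤ b _ ≤-refl)))

    mark? : ∀ j → Dec (∃[ b ] S ‼ b ≡ suc j × isMarked (T ‼ b) ≡ true)
    mark? j = any-box? λ b → (S ‼ b ≟ suc j) ×-dec (isMarked (T ‼ b) Bool.≟ true)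

    at-applyUpTo : ∀ (f : ℕ → Bool) n j → j < n → at (applyUpTo f n) j ≡ f j
    at-applyUpTo f (suc n) zero    _         = refl
    at-applyUpTo f (suc n) (suc j) (s≤s j<n) = at-applyUpTo (f ∘ suc) n j j<n

  marks : List Bool
  marks = applyUpTo (does ∘ mark?) (suc m)

  private
    at-marks : ∀ b → at marks (pos b) ≡ isMarked (T ‼ b)
    at-marks b = trans (at-applyUpTo (does ∘ mark?) (suc m) (pos b) (pos< b)) (agree (isMarked (T ‼ b)) refl)
      where
      agree : ∀ x → isMarked (T ‼ b) ≡ x → does (mark? (pos b)) ≡ x
      agree true  eq = dec-true (mark? (pos b)) (b , sym (suc-pos b) , eq)
      agree false eq = dec-false (mark? (pos b)) λ (b′ , Sb′ , eq′) →
        contra (trans (sym eq) (trans (cong (λ c → isMarked (T ‼ c))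
          (S-injective b b′ (trans (sym (suc-pos b)) (sym Sb′)))) eq′))
        where
        contra : false ≢ true
        contra ()

  -- Consecutive ranks have increasing keys, and their rows decide whether the first is a descent,
  -- so `⊏⇒allowed` applies to each pair of neighbours.
  marks-path : IsPath (markOK (descents S) (at es)) true (suc m) marks
  marks-path = Listₚ.length-applyUpTo (does ∘ mark?) (suc m) , steps
    where
    steps : ∀ j → j < suc m → markOK (descents S) (at es) j (at (true ∷ marks) j) (at marks j) ≡ true
    steps zero    _   = refl
    steps (suc j) j<m
      with spct-surjective std-SPCT (suc j) (s≤s z≤n) (subst (suc j ≤_) (sym sumα) (<⇒≤ j<m))
         | spct-surjective std-SPCT (suc (suc j)) (s≤s z≤n) (subst (suc (suc j) ≤_) (sym sumα) j<m)
    ... | b , Sb | b′ , Sb′ = subst₂ (λ x y → allowed (descents S j) (at es j) x y ≡ true)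
      (trans (sym (at-marks b)) (cong (at marks) pos-b)) (trans (sym (at-marks b′)) (cong (at marks) pos-b′))
      (⊏⇒allowed (descents S j) (at es j) (T ‼ b) (T ‼ b′) b b′
        (<⇒⊏ b b′ (subst₂ _<_ (sym Sb) (sym Sb′) ≤-refl))
        (λ ¬e → trans (value≡blk b) (trans (cong (blk es) pos-b) (trans (sym (blk-suc-false es j ¬e))
          (trans (cong (blk es) (sym pos-b′)) (sym (value≡blk b′))))))
        (λ r< → dec-true (descent? S (suc j)) (b , b′ , Sb , Sb′ , r<))
        (λ r≥ → dec-false (descent? S (suc j)) λ (c , c′ , Sc , Sc′ , r<) →
          <⇒≱ (subst₂ (λ x y → row x < row y) (S-injective c b (trans Sc (sym Sb)))
            (S-injective c′ b′ (trans Sc′ (sym Sb′))) r<) r≥))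
      where
      pos-b : pos b ≡ j
      pos-b = cong (_∸ 1) Sb
      pos-b′ : pos b′ ≡ suc j
      pos-b′ = cong (_∸ 1) Sb′

  relabel-std : relabel es marks S ≡ T
  relabel-std = filling-ext (relabel es marks S) T λ b → trans (fill-‼ _ b)
    (trans (cong₂ letter (at-marks b) (sym (value≡blk b))) (letter-η (T ‼ b)))

-- Comparison of coefficients

-- If some value up to the maximum did not occur, packedness would exclude all larger values too,
-- and the maximum would not be attained.
weight-positive : ∀ {α} (T : Filling Letter α) → IsMPCT T → All (0 <_) (weight T)
weight-positive T (_ , packed) = Allₚ.map⁺ (All.tabulate λ {i} i∈ →
  let (1≤i , i≤max) = ∈-1…⁻ (maxValue T) i∈ in positive i 1≤i i≤max)
  where
  positive : ∀ i → 1 ≤ i → i ≤ maxValue T → 0 < wt T i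
  positive (suc i) 1≤i i<max = n≢0⇒n>0 λ wt≡0 → <⇒≱ i<max (max≤ T λ b → value≤i wt≡0 b)
    where
    value≤i : wt T (suc i) ≡ 0 → ∀ b → value (T ‼ b) ≤ i
    value≤i wt≡0 b with <-cmp (value (T ‼ b)) (suc i)
    ... | tri< (s≤s v≤i) _ _ = v≤i
    ... | tri≈ _ v≡ _        = ⊥-elim (wt-value T b (trans (cong (wt T) v≡) wt≡0))
    ... | tri> _ _ v>        = ⊥-elim (wt-value T b (packed (suc i) (value (T ‼ b)) 1≤i v> wt≡0))

module _ (m : ℕ) (α : List ℕ) (sumα : sum α ≡ suc m) (shape : PeakShape α) (e : Monomial) where

  private
    Peak↑-≡ : ∀ (S : Filling ℕ α) → Peak↑ S ≡ Peak (filter (descent? S) (1… m))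
    Peak↑-≡ S = cong (λ k → Peak (filter (descent? S) (1… k))) (cong (_∸ 1) sumα)

    K-Peak↑ : ∀ (S : Filling ℕ α) → K (comp (suc m) (Peak↑ S)) e
                                  ≡ K (comp (suc m) (Peak (filter (descent? S) (1… m)))) e
    K-Peak↑ S = cong (λ P → K (comp (suc m) P) e) (Peak↑-≡ S)

    Q̃-zero : ¬ flat e ⊨ suc m → Q̃ α e ≡ ℤ.0ℤ
    Q̃-zero ¬⊨ = ∑-zero (MPCT α) (M ∘ weight) e λ {T} t → M-miss e (weight-positive T t) λ eq →
      ¬⊨ (subst (_⊨ suc m) eq
        (weight-positive T t , trans (sum-weight T (IsMarkedTableau.positive (proj₁ t))) sumα))

    module _ {es : List Bool} (len : length es ≡ m) (γ : decode es ≡ flat e) where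

      marksOf : Filling ℕ α → List (List Bool)
      marksOf S = markings (descents S) (at es) m

      relabellings : Filling ℕ α → List (Filling Letter α)
      relabellings S = map (λ w → relabel es w S) (marksOf S)

      pathOf : ∀ S {w} → w ∈ marksOf S → IsPath (markOK (descents S) (at es)) true (suc m) w
      pathOf S = to (∈-paths (markOK (descents S) (at es)) true (suc m))

      std-relabelling : ∀ {S T} → IsSPCT S → T ∈ relabellings S → std T ≡ S
      std-relabelling {S} spct T∈ with ∈-map⁻ (λ w → relabel es w S) T∈
      ... | w , w∈ , refl = Relabel.std-relabel shape sumα spct {es = es} len (pathOf S w∈)

      -- Every position of the word is held by some box of `S`, whose letter in the relabelled
      -- tableau shows the mark.
      relabel-injective : ∀ {S w w′} → IsSPCT S → w ∈ marksOf S → w′ ∈ marksOf S →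
                          relabel es w S ≡ relabel es w′ S → w ≡ w′
      relabel-injective {S} {w} {w′} spct w∈ w′∈ eq =
        at-ext w w′ (trans len-w (sym len-w′)) λ j j< → agree j (subst (j <_) len-w j<)
        where
        len-w  = proj₁ (pathOf S w∈)
        len-w′ = proj₁ (pathOf S w′∈)
        agree : ∀ j → j < suc m → at w j ≡ at w′ j
        agree j j<n with spct-surjective spct (suc j) (s≤s z≤n) (subst (suc j ≤_) (sym sumα) j<n)
        ... | b , Sb = subst (λ i → at w i ≡ at w′ i) (cong (_∸ 1) Sb)
          (trans (sym (Relabel.isMarked-relabel shape sumα spct {es = es} len (pathOf S w∈) b))
            (trans (cong (λ T → isMarked (T ‼ b)) eq)
              (Relabel.isMarked-relabel shape sumα spct {es = es} len (pathOf S w′∈) b)))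

      spctOf : ∀ {S} → S ∈ elements (SPCT α) → IsSPCT S
      spctOf = to (member (SPCT α))

      all-relabellings : List (Filling Letter α)
      all-relabellings = concatMap relabellings (elements (SPCT α))

      -- Relabellings of different standard tableaux never coincide, since `std` recovers the
      -- tableau.
      all-relabellings-unique : Unique all-relabellings
      all-relabellings-unique = concatMap-unique relabellings (elements (SPCT α)) (unique (SPCT α))
        (λ {S} S∈ → map-unique (λ w → relabel es w S) (marksOf S)
          (paths-unique (markOK (descents S) (at es)) true (suc m)) (relabel-injective (spctOf S∈)))
        (λ S∈ S′∈ T∈ T∈′ → trans (sym (std-relabelling (spctOf S∈) T∈)) (std-relabelling (spctOf S′∈) T∈′))

      weighted : List (Filling Letter α)
      weighted = filter (λ T → weight T ≟ᴸ flat e) (elements (MPCT α))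

      weighted⇒relabelling : ∀ {T} → T ∈ weighted → T ∈ all-relabellings
      weighted⇒relabelling {T} T∈ = ∈-concatMap⁺ relabellings (lose (from (member (SPCT α)) Std.std-SPCT)
          (subst (_∈ relabellings (std T)) Std.relabel-std (∈-map⁺ (λ w → relabel es w (std T))
            (from (∈-paths (markOK (descents (std T)) (at es)) true (suc m)) Std.marks-path))))
        where
        T∈MPCT   = proj₁ (∈-filter⁻ (λ T → weight T ≟ᴸ flat e) {xs = elements (MPCT α)} T∈)
        weight-T = proj₂ (∈-filter⁻ (λ T → weight T ≟ᴸ flat e) {xs = elements (MPCT α)} T∈)
        module Std = Standardize shape sumα (to (member (MPCT α)) T∈MPCT) {es = es} len
                       (trans weight-T (sym γ))

      relabelling-valid : ∀ {S T} → IsSPCT S → T ∈ relabellings S → IsMPCT T × weight T ≡ decode es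
      relabelling-valid {S} spct T∈ with ∈-map⁻ (λ w → relabel es w S) T∈
      ... | w , w∈ , refl = Relabel.relabel-MPCT shape sumα spct {es = es} len (pathOf S w∈)
                          , Relabel.weight-relabel shape sumα spct {es = es} len (pathOf S w∈)

      relabelling⇒weighted : ∀ {T} → T ∈ all-relabellings → T ∈ weighted
      relabelling⇒weighted T∈ =
        let (S , S∈ , T∈S)    = find (∈-concatMap⁻ relabellings {xs = elements (SPCT α)} T∈)
            (mpct , weight-T) = relabelling-valid (spctOf S∈) T∈S
        in ∈-filter⁺ (λ T → weight T ≟ᴸ flat e) (from (member (MPCT α)) mpct) (trans weight-T γ)

      coefficients-agree : Q̃ α e ≡ ∑ (SPCT α) (λ S → K (comp (suc m) (Peak↑ S))) e
      coefficients-agree = begin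
        Q̃ α e
          ≡⟨ ∑-count (MPCT α) (M ∘ weight) e (λ T → weight T ≟ᴸ flat e)
               (λ {T} t → M-hit e (weight-positive T t)) (λ {T} t → M-miss e (weight-positive T t)) ⟩
        ℤ.+ length weighted
          ≡⟨ cong ℤ.+_ (same-length (Uniqueₚ.filter⁺ (λ T → weight T ≟ᴸ flat e) (unique (MPCT α)))
               all-relabellings-unique weighted⇒relabelling relabelling⇒weighted) ⟩
        ℤ.+ length all-relabellings
          ≡⟨ cong ℤ.+_ (length-concatMap relabellings (elements (SPCT α))) ⟩
        ℤ.+ sum (map (length ∘ relabellings) (elements (SPCT α)))
          ≡⟨ sym (∑-natural (SPCT α) (λ S → K (comp (suc m) (Peak↑ S))) e (length ∘ relabellings) λ {S} _ →
               trans (K-Peak↑ S) (trans (K-coefficient (descent? S) m e es len γ)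
                 (cong ℤ.+_ (sym (Listₚ.length-map (λ w → relabel es w S) (marksOf S)))))) ⟩
        ∑ (SPCT α) (λ S → K (comp (suc m) (Peak↑ S))) e ∎
        where open ≡-Reasoning

  -- A monomial whose degree is not n has coefficient 0 on both sides; for any other one, the
  -- nonzero exponents form a composition of n and can be encoded as a bit word.
  coefficient : Dec (flat e ⊨ suc m) → Q̃ α e ≡ ∑ (SPCT α) (λ S → K (comp (suc m) (Peak↑ S))) e
  coefficient (yes γ⊨) = let (es , len , γ) = encode m γ⊨ in coefficients-agree {es = es} len γ
  coefficient (no ¬⊨)  = trans (Q̃-zero ¬⊨) (sym (∑-zero (SPCT α) (λ S → K (comp (suc m) (Peak↑ S))) e
    λ {S} _ → trans (K-Peak↑ S) (K-coefficient-zero (descent? S) m e ¬⊨)))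

theorem3p16 : (n : ℕ) → 1 ≤ n → (α : List ℕ) → α ⊨ᴾ n →
    Q̃ α ≈ ∑ (SPCT α) (λ T → K (comp n (Peak↑ T)))
theorem3p16 (suc m) _ α ((_ , sumα) , shape) e = coefficient m α sumα shape e (⊨? (flat e) (suc m))
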